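{- Work in the theory ZF + DC + R-Unif (Zermelo–Fraenkel set theory without the full Axiom of Choice, together with the Principle of Dependent Choice and the Ramsey uniformization principle). If every set $S\subseteq[\mathbb N]^\infty$ has the Ramsey Property, then there is no infinite maximal almost disjoint family of infinite subsets of $\mathbb N$.
   Context: For a set $X$, $[X]^\infty$ denotes the set of countably infinite subsets of $X$. Ramsey Property: a set $S\subseteq[\mathbb N]^\infty$ has the Ramsey Property if there is $B\in[\mathbb N]^\infty$ such that either $[B]^\infty\subseteq S$ or $[B]^\infty\cap S=\emptyset$. Almost disjoint family: a family $\mathcal A\subseteq[\mathbb N]^\infty$ (so all members are infinite subsets of $\mathbb N$) such that for all $x,y\in\mathcal A$, either $x=y$ or $x\cap y$ is finite. A maximal almost disjoint (mad) family is an almost disjoint family that is not a proper subset of any almost disjoint family. "Infinite mad family" means that the family $\mathcal A$ has infinitely many members. R-Unif (Ramsey uniformization principle) is the following statement: for every Polish space $Y$, every $R\subseteq[\mathbb N]^\infty\times Y$, and every infinite $A\subseteq\mathbb N$ such that $[A]^\infty\subseteq\operatorname{dom}(R)=\{x\in[\mathbb N]^\infty:(\exists y\in Y)\ (x,y)\in R\}$, there are $B\in[A]^\infty$ and a function $\vartheta:[B]^\infty\to Y$ such that $(x,\vartheta(x))\in R$ for all $x\in[B]^\infty$. The Axiom of Choice is not assumed beyond DC. -}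

-- Set theory without choice is treated semantically: a statement follows from
-- ZF + DC + … when it holds in every model of these first-order axioms.
-- Every notion below is interpreted inside an arbitrary model 𝕍: quantifiers
-- range over elements of 𝕍 only, and "function", "sequence", "finite", "ℕ", …
-- are those of 𝕍.  Σ-types and Agda functions belong to the metatheory: as
-- Separation and Replacement admit only predicates given by a first-order
-- formula in ∈, a choice made outside 𝕍 puts no choice function into 𝕍.
-- Likewise excluded middle, assumed for the metatheory, makes satisfaction in
-- 𝕍 classical, as ZF requires, and gives nothing more.

module Defs where

import Level
open import Data.Empty.Polymorphic using (⊥)
open import Data.Fin.Base using (Fin)
open import Data.Fin.Patterns using (0F; 1F; 2F)
open import Data.Nat.Base using (ℕ; suc)
open import Data.Product.Base using (Σ; ∃; ∃₂; _×_; _,_; proj₁; proj₂)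
open import Data.Sum.Base using (_⊎_)
open import Data.Vec.Base using (Vec; []; _∷_; lookup)
open import Function.Base using (_on_)
open import Function.Bundles using (_⇔_)
open import Relation.Binary.Core using (Rel)
open import Relation.Binary.PropositionalEquality.Core using (_≡_; refl)
open import Relation.Binary.Structures using (IsTotalOrder)
import Relation.Binary.Construct.NonStrictToStrict as NonStrictToStrict
open import Relation.Nullary.Negation.Core using (¬_)
open import Relation.Unary using (Pred; _⊆_; _⊂_; _∩_; _≬_; _≐_)
  renaming (_⊥_ to _disjoint_)
open import Algebra.Structures using (IsCommutativeRing)

------------------------------------------------------------------------
-- First-order formulas in ∈ and =, with de Bruijn variables

infix  9 _∈ᶠ_ _≡ᶠ_
infixr 7 _∧ᶠ_
infixr 6 _∨ᶠ_
infixr 5 _⇒ᶠ_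
infix  4 _⇔ᶠ_

data Formula (n : ℕ) : Set where
  _∈ᶠ_ _≡ᶠ_                 : (i j : Fin n) → Formula n
  ⊥ᶠ                        : Formula n
  ¬ᶠ_                       : (φ : Formula n) → Formula n
  _∧ᶠ_ _∨ᶠ_ _⇒ᶠ_ _⇔ᶠ_       : (φ ψ : Formula n) → Formula n
  ∀ᶠ_ ∃ᶠ_                   : (φ : Formula (suc n)) → Formula n

module Satisfaction {ℓ} {V : Set ℓ} (_∈_ : Rel V ℓ) where

  infix 3 _⊨_

  _⊨_ : ∀ {n} → Vec V n → Formula n → Set ℓ
  ρ ⊨ i ∈ᶠ j = lookup ρ i ∈ lookup ρ j
  ρ ⊨ i ≡ᶠ j = lookup ρ i ≡ lookup ρ j
  ρ ⊨ ⊥ᶠ     = ⊥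
  ρ ⊨ ¬ᶠ φ   = ¬ (ρ ⊨ φ)
  ρ ⊨ φ ∧ᶠ ψ = (ρ ⊨ φ) × (ρ ⊨ ψ)
  ρ ⊨ φ ∨ᶠ ψ = (ρ ⊨ φ) ⊎ (ρ ⊨ ψ)
  ρ ⊨ φ ⇒ᶠ ψ = (ρ ⊨ φ) → (ρ ⊨ ψ)
  ρ ⊨ φ ⇔ᶠ ψ = (ρ ⊨ φ) ⇔ (ρ ⊨ ψ)
  ρ ⊨ ∀ᶠ φ   = ∀ x → (x ∷ ρ) ⊨ φ
  ρ ⊨ ∃ᶠ φ   = ∃ λ x → (x ∷ ρ) ⊨ φ

------------------------------------------------------------------------
-- Models of ZF

module Basic {ℓ} {V : Set ℓ} (_∈_ : Rel V ℓ) where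

  IsEmpty : Pred V ℓ
  IsEmpty e = ∀ z → ¬ (z ∈ e)

  -- s = n ∪ {n}
  IsSuccessor : V → Pred V ℓ
  IsSuccessor n s = ∀ z → z ∈ s ⇔ (z ∈ n ⊎ z ≡ n)

  IsInductive : Pred V ℓ
  IsInductive w = (∃ λ e → IsEmpty e × e ∈ w)
                × (∀ n → n ∈ w → ∃ λ s → IsSuccessor n s × s ∈ w)

record ZFModel ℓ : Set (Level.suc ℓ) where
  infix 4 _∈_
  field
    V   : Set ℓ
    _∈_ : Rel V ℓ

  open Satisfaction _∈_ public
  open Basic _∈_ public

  field
    extensionality : ∀ x y → (∀ z → z ∈ x ⇔ z ∈ y) → x ≡ y
    foundation     : ∀ x → (∃ λ y → y ∈ x) →
                     ∃ λ y → y ∈ x × (∀ z → z ∈ y → ¬ (z ∈ x))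
    pairing        : ∀ x y → ∃ λ p → ∀ z → z ∈ p ⇔ (z ≡ x ⊎ z ≡ y)
    union          : ∀ x → ∃ λ u → ∀ z → z ∈ u ⇔ (∃ λ y → y ∈ x × z ∈ y)
    powerset       : ∀ x → ∃ λ p → ∀ z → z ∈ p ⇔ (∀ y → y ∈ z → y ∈ x)
    infinity       : ∃ IsInductive
    -- In both schemas ρ supplies the parameters of φ.
    separation     : ∀ {n} (φ : Formula (suc n)) (ρ : Vec V n) a →
                     ∃ λ b → ∀ x → x ∈ b ⇔ (x ∈ a × (x ∷ ρ ⊨ φ))
    replacement    : ∀ {n} (φ : Formula (suc (suc n))) (ρ : Vec V n) a →
                     (∀ x → x ∈ a → ∀ y z →
                        (y ∷ x ∷ ρ ⊨ φ) → (z ∷ x ∷ ρ ⊨ φ) → y ≡ z) →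
                     ∃ λ b → ∀ y → y ∈ b ⇔ (∃ λ x → x ∈ a × (y ∷ x ∷ ρ ⊨ φ))

------------------------------------------------------------------------

module InModel {ℓ} (𝕍 : ZFModel ℓ) where

  open ZFModel 𝕍 public

  Class : Set (Level.suc ℓ)
  Class = Pred V ℓ

  ⌜_⌝ : V → Class
  ⌜ X ⌝ = λ x → x ∈ X

  El : Class → Set ℓ
  El P = ∃ P

  infix 4 _≈_
  _≈_ : {P : Class} → Rel (El P) ℓ
  _≈_ = _≡_ on proj₁

  -- IsInductive w, for w the variable 0
  inductiveᶠ : ∀ {n} → Formula (suc n)
  inductiveᶠ =
      (∃ᶠ ((∀ᶠ (¬ᶠ (0F ∈ᶠ 1F))) ∧ᶠ (0F ∈ᶠ 1F)))
    ∧ᶠ (∀ᶠ ((0F ∈ᶠ 1F) ⇒ᶠ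
         (∃ᶠ ((∀ᶠ ((0F ∈ᶠ 1F) ⇔ᶠ ((0F ∈ᶠ 2F) ∨ᶠ (0F ≡ᶠ 2F))))
           ∧ᶠ (0F ∈ᶠ 2F)))))

  -- The least inductive set, playing the role of ℕ
  least-inductive : ∃ λ w → ∀ x →
    x ∈ w ⇔ (x ∈ proj₁ infinity × (∀ v → IsInductive v → x ∈ v))
  least-inductive =
    separation (∀ᶠ (inductiveᶠ ⇒ᶠ (1F ∈ᶠ 0F))) [] (proj₁ infinity)

  ω : V
  ω = proj₁ least-inductive

  ----------------------------------------------------------------------
  -- Ordered pairs and functions

  unordered : V → V → V
  unordered x y = proj₁ (pairing x y)

  -- Kuratowski pairs
  ⟨_,_⟩ : V → V → V
  ⟨ x , y ⟩ = unordered (unordered x x) (unordered x y)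

  infixr 6 _⊗_
  _⊗_ : Class → Class → Class
  (P ⊗ Q) p = ∃₂ λ x y → P x × Q y × p ≡ ⟨ x , y ⟩

  infix 4 _∶_⟶_
  record _∶_⟶_ (f : V) (P Q : Class) : Set ℓ where
    field
      graph  : ⌜ f ⌝ ⊆ P ⊗ Q
      total  : ∀ x → P x → ∃ λ y → Q y × ⟨ x , y ⟩ ∈ f
      unique : ∀ x y z → ⟨ x , y ⟩ ∈ f → ⟨ x , z ⟩ ∈ f → y ≡ z

  apply : ∀ {f P Q} → f ∶ P ⟶ Q → El P → El Q
  apply F (x , Px) = let (y , Qy , _) = _∶_⟶_.total F x Px in y , Qy

  apply₂ : ∀ {f P Q R} → f ∶ P ⊗ Q ⟶ R → El P → El Q → El R
  apply₂ F (x , Px) (y , Qy) =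
    apply F (⟨ x , y ⟩ , x , y , Px , Qy , refl)

  IsInjective : Pred V ℓ
  IsInjective f = ∀ x y z → ⟨ x , z ⟩ ∈ f → ⟨ y , z ⟩ ∈ f → x ≡ y

  IsOnto : V → Class → Set ℓ
  IsOnto f Q = ∀ y → Q y → ∃ λ x → ⟨ x , y ⟩ ∈ f

  Bijection : Class → Class → Set ℓ
  Bijection P Q = ∃ λ f → f ∶ P ⟶ Q × IsInjective f × IsOnto f Q

  Finite Countable CountablyInfinite : Class → Set ℓ
  Finite P            = ∃ λ n → n ∈ ω × Bijection ⌜ n ⌝ P
  Countable P         = ∃ λ f → f ∶ P ⟶ ⌜ ω ⌝ × IsInjective f
  CountablyInfinite P = Bijection ⌜ ω ⌝ P

  [_]^∞ : V → Class
  [ X ]^∞ x = ⌜ x ⌝ ⊆ ⌜ X ⌝ × CountablyInfinite ⌜ x ⌝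

  ----------------------------------------------------------------------
  -- The real line, up to isomorphism, as a complete ordered field

  record CompleteOrderedField : Set ℓ where
    field
      F add mul neg leq : V
      add-fun : add ∶ ⌜ F ⌝ ⊗ ⌜ F ⌝ ⟶ ⌜ F ⌝
      mul-fun : mul ∶ ⌜ F ⌝ ⊗ ⌜ F ⌝ ⟶ ⌜ F ⌝
      neg-fun : neg ∶ ⌜ F ⌝ ⟶ ⌜ F ⌝
      0# 1#   : El ⌜ F ⌝

    infix  4 _≤_
    infixl 6 _+_
    infixl 7 _*_

    _+_ : El ⌜ F ⌝ → El ⌜ F ⌝ → El ⌜ F ⌝
    _+_ = apply₂ add-fun

    _*_ : El ⌜ F ⌝ → El ⌜ F ⌝ → El ⌜ F ⌝
    _*_ = apply₂ mul-fun

    -_ : El ⌜ F ⌝ → El ⌜ F ⌝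
    -_ = apply neg-fun

    _≤_ : Rel (El ⌜ F ⌝) ℓ
    x ≤ y = ⟨ proj₁ x , proj₁ y ⟩ ∈ leq

    UpperBound : V → Pred (El ⌜ F ⌝) ℓ
    UpperBound S u = ∀ x → proj₁ x ∈ S → x ≤ u

    field
      isCommutativeRing : IsCommutativeRing _≈_ _+_ _*_ -_ 0# 1#
      0≉1               : ¬ (0# ≈ 1#)
      inverse           : ∀ x → ¬ (x ≈ 0#) → ∃ λ y → x * y ≈ 1#
      isTotalOrder      : IsTotalOrder _≈_ _≤_
      +-monoˡ-≤         : ∀ x y z → x ≤ y → x + z ≤ y + z
      *-nonneg          : ∀ x y → 0# ≤ x → 0# ≤ y → 0# ≤ x * y
      supremum          : ∀ S → ⌜ S ⌝ ⊆ ⌜ F ⌝ → (∃ λ x → x ∈ S) →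
                          ∃ (UpperBound S) →
                          ∃ λ u → UpperBound S u × (∀ v → UpperBound S v → u ≤ v)

    open NonStrictToStrict _≈_ _≤_ public using (_<_)

  ----------------------------------------------------------------------
  -- Polish spaces

  module _ (ℝ : CompleteOrderedField) where

    open CompleteOrderedField ℝ

    record Metric (Y : V) : Set ℓ where
      field
        d     : V
        d-fun : d ∶ ⌜ Y ⌝ ⊗ ⌜ Y ⌝ ⟶ ⌜ F ⌝

      dist : El ⌜ Y ⌝ → El ⌜ Y ⌝ → El ⌜ F ⌝
      dist = apply₂ d-fun

      field
        nonneg    : ∀ x y → 0# ≤ dist x y
        zero-dist : ∀ x y → dist x y ≈ 0# ⇔ x ≈ y
        symmetric : ∀ x y → dist x y ≈ dist y x
        triangle  : ∀ x y z → dist x z ≤ dist x y + dist y z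

      IsOpen : Pred V ℓ
      IsOpen U = ⌜ U ⌝ ⊆ ⌜ Y ⌝ ×
        (∀ x → proj₁ x ∈ U →
           ∃ λ ε → 0# < ε × (∀ y → dist x y < ε → proj₁ y ∈ U))

      -- For natural numbers, N ∈ n means N < n.
      IsCauchy : ∀ {s} → s ∶ ⌜ ω ⌝ ⟶ ⌜ Y ⌝ → Set ℓ
      IsCauchy s = ∀ ε → 0# < ε → ∃ λ N → N ∈ ω ×
        (∀ m n → N ∈ proj₁ m → N ∈ proj₁ n →
           dist (apply s m) (apply s n) < ε)

      ConvergesTo : ∀ {s} → s ∶ ⌜ ω ⌝ ⟶ ⌜ Y ⌝ → Pred (El ⌜ Y ⌝) ℓ
      ConvergesTo s y = ∀ ε → 0# < ε → ∃ λ N → N ∈ ω ×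
        (∀ n → N ∈ proj₁ n → dist (apply s n) y < ε)

      IsComplete : Set ℓ
      IsComplete = ∀ {s} (s-fun : s ∶ ⌜ ω ⌝ ⟶ ⌜ Y ⌝) →
                   IsCauchy s-fun → ∃ (ConvergesTo s-fun)

  IsSeparable : V → V → Set ℓ
  IsSeparable Y τ = ∃ λ D → ⌜ D ⌝ ⊆ ⌜ Y ⌝ × Countable ⌜ D ⌝ ×
    (∀ U → U ∈ τ → (∃ λ x → x ∈ U) → ⌜ D ⌝ ≬ ⌜ U ⌝)

  -- ZF proves that a complete ordered field exists and is unique up to
  -- isomorphism, so here "for every ℝ" and "for some ℝ" mean the same.
  IsCompletelyMetrizable : V → V → Set ℓ
  IsCompletelyMetrizable Y τ = ∀ (ℝ : CompleteOrderedField) →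
    ∃ λ (δ : Metric ℝ Y) → ⌜ τ ⌝ ≐ Metric.IsOpen δ × Metric.IsComplete δ

  -- That τ is a topology on Y follows from its being a metric topology.
  IsPolish : V → V → Set ℓ
  IsPolish Y τ = IsSeparable Y τ × IsCompletelyMetrizable Y τ

  ----------------------------------------------------------------------
  -- Choice principles

  DependentChoice : Set ℓ
  DependentChoice = ∀ X R → (∃ λ x → x ∈ X) → ⌜ R ⌝ ⊆ ⌜ X ⌝ ⊗ ⌜ X ⌝ →
    (∀ x → x ∈ X → ∃ λ y → y ∈ X × ⟨ x , y ⟩ ∈ R) →
    ∃ λ f → Σ (f ∶ ⌜ ω ⌝ ⟶ ⌜ X ⌝) λ f-fun →
      ∀ m n → IsSuccessor (proj₁ m) (proj₁ n) →
        ⟨ proj₁ (apply f-fun m) , proj₁ (apply f-fun n) ⟩ ∈ R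

  RUnif : Set ℓ
  RUnif = ∀ Y τ → IsPolish Y τ →
    ∀ R → ⌜ R ⌝ ⊆ [ ω ]^∞ ⊗ ⌜ Y ⌝ →
    ∀ A → [ ω ]^∞ A →
    (∀ x → [ A ]^∞ x → ∃ λ y → y ∈ Y × ⟨ x , y ⟩ ∈ R) →
    ∃ λ B → [ A ]^∞ B × ∃ λ ϑ → Σ (ϑ ∶ [ B ]^∞ ⟶ ⌜ Y ⌝) λ ϑ-fun →
      ∀ x → ⟨ proj₁ x , proj₁ (apply ϑ-fun x) ⟩ ∈ R

  ----------------------------------------------------------------------
  -- The Ramsey property and mad families

  HasRamseyProperty : Pred V ℓ
  HasRamseyProperty S = ∃ λ B → [ ω ]^∞ B ×
    ([ B ]^∞ ⊆ ⌜ S ⌝ ⊎ [ B ]^∞ disjoint ⌜ S ⌝)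

  AlmostDisjoint : Pred V ℓ
  AlmostDisjoint 𝒜 = ⌜ 𝒜 ⌝ ⊆ [ ω ]^∞ ×
    (∀ x y → x ∈ 𝒜 → y ∈ 𝒜 → x ≡ y ⊎ Finite (⌜ x ⌝ ∩ ⌜ y ⌝))

  IsMad : Pred V ℓ
  IsMad 𝒜 = AlmostDisjoint 𝒜 ×
    (∀ ℬ → AlmostDisjoint ℬ → ¬ (⌜ 𝒜 ⌝ ⊂ ⌜ ℬ ⌝))

{-# OPTIONS --safe #-}
-- Choose distinct members x₀, x₁, … of a mad family 𝒜 and put
-- T(a,b) = min {k ∈ x_a : b < k}.  Pair off the elements of an infinite set
-- z = {z₀ < z₁ < …} as (z₀,z₁), (z₂,z₃), …, and let S be the set of those z for
-- which one y ∈ 𝒜 contains T(z₀,z₁), T(z₂,z₃), ….  Let B be homogeneous for S.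
-- The values of T on the pairs of an infinite subset of B meet some y ∈ 𝒜 in an
-- infinite set, and the pairs with value in y form an element of S; so
-- [B]^∞ ⊆ S.  In particular some y ∈ 𝒜 contains all values of T on the pairs of B.
-- Since the x_a are distinct, there are a < b in B with T(a,b) ∉ y.  Putting
-- (a,b) in front of the pairs of B above b gives an infinite subset of B, whose
-- values lie in some y′ ∈ 𝒜.  Then y ∩ y′ is infinite, so y = y′ ∋ T(a,b), a
-- contradiction.

module Submission where

open import Defs
open import Axiom.DoubleNegationElimination using (em⇒dne)
open import Axiom.ExcludedMiddle using (ExcludedMiddle)
open import Data.Empty using (⊥-elim)
open import Data.Fin.Base using (Fin; suc)
open import Data.Fin.Patterns using (0F; 1F; 2F; 3F; 4F; 5F; 6F; 7F; 8F; 9F)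
open import Data.Nat.Base using (suc)
open import Data.Product.Base using (∃; ∃₂; _×_; _,_; proj₁; proj₂)
open import Data.Product.Function.NonDependent.Propositional using (_×-⇔_)
open import Data.Sum.Base using (_⊎_; inj₁; inj₂; [_,_]′)
open import Data.Sum.Function.Propositional using (_⊎-⇔_)
open import Data.Vec.Base using (Vec; []; _∷_; lookup)
open import Function.Base using (_∘_; id)
open import Function.Bundles using (_⇔_; mk⇔; module Equivalence)
open import Function.Construct.Composition using (_⇔-∘_)
open import Function.Construct.Identity using (⇔-id)
open import Function.Construct.Symmetry using (⇔-sym)
open import Function.Related.TypeIsomorphisms using (→-cong-⇔; ¬-cong-⇔)
open import Relation.Binary.PropositionalEquality.Core
  using (_≡_; refl; sym; trans; cong; subst)
open import Relation.Nullary.Decidable.Core using (yes; no)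
open import Relation.Nullary.Negation.Core using (¬_)
open import Relation.Unary using (_⊆_; _∩_)
open Equivalence using (to; from)

-- Homogeneity concerns subsets of `B`, whereas the argument manipulates sets of pairs. Pairs that
-- do not overlap can be recovered from the set of their endpoints, so dropping pairs, or grafting
-- one pair below others, again amounts to passing to an infinite subset of `B`. The two entries of
-- a pair have different tasks. The second makes values large: as `b < T(a,b)`, infinitely many such
-- pairs yield an infinite set of values, to which maximality applies. The first gives access to a
-- member of the family other than `y`: at most one index `a` has x_a = y, and for any other `a` the
-- set x_a ∩ y is finite, so a large `b` pushes `T(a,b)` out of `y`. Dependent choice serves both
-- for the sequence of the x_a and for picking infinitely many non-overlapping pairs from `B`. As
-- Separation accepts only first-order formulas, each induction and each comprehension carries a
-- proof that its predicate is definable.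

module MadFamilies {ℓ} (em : ExcludedMiddle ℓ) (𝕍 : ZFModel ℓ) where

  open InModel 𝕍

  dne : {P : Set ℓ} → ¬ ¬ P → P
  dne = em⇒dne em

  -- Definable predicates

  -- The predicate P is computed from the combinators below, so that instances of
  -- Separation come out in terms of Agda connectives rather than _⊨_.
  record Definable {n} (P : Vec V n → Set ℓ) : Set ℓ where
    constructor _because_
    field
      formula : Formula n
      correct : ∀ ρ → (ρ ⊨ formula) ⇔ P ρ

  infix  9 _∈ᵈ_ _≡ᵈ_
  infixr 7 _×ᵈ_
  infixr 6 _⊎ᵈ_
  infixr 5 _→ᵈ_
  infix  4 _⇔ᵈ_

  opaque
    _∈ᵈ_ : ∀ {n} (i j : Fin n) → Definable (λ ρ → lookup ρ i ∈ lookup ρ j)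
    i ∈ᵈ j = (i ∈ᶠ j) because λ _ → ⇔-id _

    _≡ᵈ_ : ∀ {n} (i j : Fin n) → Definable (λ ρ → lookup ρ i ≡ lookup ρ j)
    i ≡ᵈ j = (i ≡ᶠ j) because λ _ → ⇔-id _

    ¬ᵈ_ : ∀ {n} {P : Vec V n → Set ℓ} → Definable P → Definable (λ ρ → ¬ P ρ)
    ¬ᵈ (φ because φ⇔P) = (¬ᶠ φ) because λ ρ → ¬-cong-⇔ (φ⇔P ρ)

    _×ᵈ_ : ∀ {n} {P Q : Vec V n → Set ℓ} →
           Definable P → Definable Q → Definable (λ ρ → P ρ × Q ρ)
    (φ because φ⇔P) ×ᵈ (ψ because ψ⇔Q) = (φ ∧ᶠ ψ) because λ ρ → φ⇔P ρ ×-⇔ ψ⇔Q ρ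

    _⊎ᵈ_ : ∀ {n} {P Q : Vec V n → Set ℓ} →
           Definable P → Definable Q → Definable (λ ρ → P ρ ⊎ Q ρ)
    (φ because φ⇔P) ⊎ᵈ (ψ because ψ⇔Q) = (φ ∨ᶠ ψ) because λ ρ → φ⇔P ρ ⊎-⇔ ψ⇔Q ρ

    _→ᵈ_ : ∀ {n} {P Q : Vec V n → Set ℓ} →
           Definable P → Definable Q → Definable (λ ρ → P ρ → Q ρ)
    (φ because φ⇔P) →ᵈ (ψ because ψ⇔Q) =
      (φ ⇒ᶠ ψ) because λ ρ → →-cong-⇔ (φ⇔P ρ) (ψ⇔Q ρ)

    _⇔ᵈ_ : ∀ {n} {P Q : Vec V n → Set ℓ} →
           Definable P → Definable Q → Definable (λ ρ → P ρ ⇔ Q ρ)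
    (φ because φ⇔P) ⇔ᵈ (ψ because ψ⇔Q) = (φ ⇔ᶠ ψ) because λ ρ → mk⇔
      (λ e → ψ⇔Q ρ ⇔-∘ (e ⇔-∘ ⇔-sym (φ⇔P ρ)))
      (λ e → ⇔-sym (ψ⇔Q ρ) ⇔-∘ (e ⇔-∘ φ⇔P ρ))

    ∀ᵈ_ : ∀ {n} {P : Vec V (suc n) → Set ℓ} →
          Definable P → Definable (λ ρ → ∀ x → P (x ∷ ρ))
    ∀ᵈ (φ because φ⇔P) = (∀ᶠ φ) because λ ρ → mk⇔
      (λ f x → to (φ⇔P (x ∷ ρ)) (f x)) (λ f x → from (φ⇔P (x ∷ ρ)) (f x))

    ∃ᵈ_ : ∀ {n} {P : Vec V (suc n) → Set ℓ} →
          Definable P → Definable (λ ρ → ∃ λ x → P (x ∷ ρ))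
    ∃ᵈ (φ because φ⇔P) = (∃ᶠ φ) because λ ρ → mk⇔
      (λ (x , p) → x , to (φ⇔P (x ∷ ρ)) p) (λ (x , p) → x , from (φ⇔P (x ∷ ρ)) p)

    -- Formulas have neither function symbols nor records; this step brings in terms such as
    -- `⟨ x , y ⟩` and predicates such as `Captured`, once they are unfolded into an equivalent
    -- first-order form.
    mapᵈ : ∀ {n} {P Q : Vec V n → Set ℓ} →
           Definable P → (∀ ρ → P ρ ⇔ Q ρ) → Definable Q
    mapᵈ (φ because φ⇔P) P⇔Q = φ because λ ρ → P⇔Q ρ ⇔-∘ φ⇔P ρ

    comprehension : ∀ {n} {P : Vec V (suc n) → Set ℓ} → Definable P →
                    ∀ ρ a → ∃ λ b → ∀ x → x ∈ b ⇔ (x ∈ a × P (x ∷ ρ))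
    comprehension (φ because φ⇔P) ρ a with separation φ ρ a
    ... | b , b-spec = b , λ x → (⇔-id _ ×-⇔ φ⇔P (x ∷ ρ)) ⇔-∘ b-spec x

  -- Basic sets

  ≡-ext : ∀ {x y} → (∀ z → z ∈ x → z ∈ y) → (∀ z → z ∈ y → z ∈ x) → x ≡ y
  ≡-ext x⊆y y⊆x = extensionality _ _ λ z → mk⇔ (x⊆y z) (y⊆x z)

  x∉x : ∀ {x} → ¬ (x ∈ x)
  x∉x {x} x∈x with pairing x x
  ... | s , s-spec with foundation s (x , from (s-spec x) (inj₁ refl))
  ... | y , y∈s , y-min = [ y≡x⇒ , y≡x⇒ ]′ (to (s-spec y) y∈s)
    where
    y≡x⇒ : y ≡ x → _
    y≡x⇒ refl = y-min x x∈x y∈s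

  ∈-unordered : ∀ {x y z} → z ∈ unordered x y ⇔ (z ≡ x ⊎ z ≡ y)
  ∈-unordered {x} {y} {z} = proj₂ (pairing x y) z

  ∈-unorderedˡ : ∀ {x y} → x ∈ unordered x y
  ∈-unorderedˡ = from ∈-unordered (inj₁ refl)

  ∈-unorderedʳ : ∀ {x y} → y ∈ unordered x y
  ∈-unorderedʳ = from ∈-unordered (inj₂ refl)

  ∈-singleton⁻ : ∀ {x z} → z ∈ unordered x x → z ≡ x
  ∈-singleton⁻ z∈x = [ id , id ]′ (to ∈-unordered z∈x)

  opaque
    ∅ : V
    ∅ = proj₁ (proj₁ (proj₂ infinity))

    ∉∅ : ∀ {z} → ¬ (z ∈ ∅)
    ∉∅ {z} = proj₁ (proj₂ (proj₁ (proj₂ infinity))) z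

    infixr 6 _∪_
    _∪_ : V → V → V
    x ∪ y = proj₁ (union (unordered x y))

    ∈-∪ : ∀ {x y z} → z ∈ (x ∪ y) ⇔ (z ∈ x ⊎ z ∈ y)
    ∈-∪ {x} {y} {z} = mk⇔ ∪⁻ ∪⁺
      where
      spec : z ∈ (x ∪ y) ⇔ ∃ λ w → w ∈ unordered x y × z ∈ w
      spec = proj₂ (union (unordered x y)) z
      ∪⁻ : z ∈ (x ∪ y) → z ∈ x ⊎ z ∈ y
      ∪⁻ z∈ with to spec z∈
      ... | w , w∈ , z∈w with to ∈-unordered w∈
      ... | inj₁ refl = inj₁ z∈w
      ... | inj₂ refl = inj₂ z∈w
      ∪⁺ : z ∈ x ⊎ z ∈ y → z ∈ (x ∪ y)
      ∪⁺ (inj₁ z∈x) = from spec (x , ∈-unorderedˡ , z∈x)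
      ∪⁺ (inj₂ z∈y) = from spec (y , ∈-unorderedʳ , z∈y)

    infixl 7 _∪❴_❵
    _∪❴_❵ : V → V → V
    x ∪❴ y ❵ = x ∪ unordered y y

    ∈-∪❴❵ : ∀ {x y z} → z ∈ (x ∪❴ y ❵) ⇔ (z ∈ x ⊎ z ≡ y)
    ∈-∪❴❵ = mk⇔ (λ z∈ → [ inj₁ , inj₂ ∘ ∈-singleton⁻ ]′ (to ∈-∪ z∈))
      λ { (inj₁ z∈x) → from ∈-∪ (inj₁ z∈x)
        ; (inj₂ refl) → from ∈-∪ (inj₂ ∈-unorderedˡ) }

  -- Ordered pairs

  pair-injectiveˡ : ∀ {a b c d} → ⟨ a , b ⟩ ≡ ⟨ c , d ⟩ → a ≡ c
  pair-injectiveˡ {a} {b} {c} {d} eq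
    with to ∈-unordered (subst (unordered a a ∈_) eq ∈-unorderedˡ)
  ... | inj₁ aa≡cc = sym (∈-singleton⁻ (subst (c ∈_) (sym aa≡cc) ∈-unorderedˡ))
  ... | inj₂ aa≡cd = sym (∈-singleton⁻ (subst (c ∈_) (sym aa≡cd) ∈-unorderedˡ))

  -- The degenerate alternative `d ≡ a` is settled by applying the lemma a second time, with the
  -- roles of `b` and `d` exchanged.
  pair-second : ∀ {a b d} → ⟨ a , b ⟩ ≡ ⟨ a , d ⟩ → d ≡ a ⊎ d ≡ b
  pair-second {a} {b} {d} eq
    with to ∈-unordered (subst (unordered a d ∈_) (sym eq) ∈-unorderedʳ)
  ... | inj₁ ad≡aa = inj₁ (∈-singleton⁻ (subst (d ∈_) ad≡aa ∈-unorderedʳ))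
  ... | inj₂ ad≡ab = to ∈-unordered (subst (d ∈_) ad≡ab ∈-unorderedʳ)

  pair-injective : ∀ {a b c d} → ⟨ a , b ⟩ ≡ ⟨ c , d ⟩ → a ≡ c × b ≡ d
  pair-injective eq with pair-injectiveˡ eq
  ... | refl with pair-second eq | pair-second (sym eq)
  ... | inj₂ refl | _         = refl , refl
  ... | inj₁ refl | inj₁ refl = refl , refl
  ... | inj₁ refl | inj₂ refl = refl , refl

  opaque
    unorderedᵈ : ∀ {n} (k i j : Fin n) →
      Definable (λ ρ → lookup ρ k ≡ unordered (lookup ρ i) (lookup ρ j))
    unorderedᵈ k i j = mapᵈ
      (∀ᵈ (0F ∈ᵈ suc k ⇔ᵈ 0F ≡ᵈ suc i ⊎ᵈ 0F ≡ᵈ suc j))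
      (λ ρ → mk⇔ (λ h → extensionality _ _ λ z → ⇔-sym ∈-unordered ⇔-∘ h z)
                 λ { eq z → subst (λ s → z ∈ s ⇔ _) (sym eq) ∈-unordered })

    pairᵈ : ∀ {n} (k i j : Fin n) →
      Definable (λ ρ → lookup ρ k ≡ ⟨ lookup ρ i , lookup ρ j ⟩)
    pairᵈ k i j = mapᵈ
      (∃ᵈ (unorderedᵈ 0F (suc i) (suc i) ×ᵈ
      (∃ᵈ (unorderedᵈ 0F (suc (suc i)) (suc (suc j)) ×ᵈ
        unorderedᵈ (suc (suc k)) 1F 0F))))
      (λ ρ → mk⇔ (λ { (_ , refl , _ , refl , eq) → eq })
                 λ eq → _ , refl , _ , refl , eq)

    ⟨_,_⟩∈ᵈ_ : ∀ {n} (i j k : Fin n) →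
      Definable (λ ρ → ⟨ lookup ρ i , lookup ρ j ⟩ ∈ lookup ρ k)
    ⟨ i , j ⟩∈ᵈ k = mapᵈ
      (∃ᵈ (pairᵈ 0F (suc i) (suc j) ×ᵈ 0F ∈ᵈ suc k))
      (λ ρ → mk⇔ (λ { (_ , refl , p∈k) → p∈k }) λ p∈k → _ , refl , p∈k)

  -- Products and relations

  opaque
    -- Kuratowski pairs are sets of subsets of `A ∪ B`, so the double power set bounds the
    -- Separation.
    product : ∀ A B → ∃ λ C → ∀ p → p ∈ C ⇔ (⌜ A ⌝ ⊗ ⌜ B ⌝) p
    product A B with powerset (A ∪ B)
    ... | 𝒫 , 𝒫-spec with powerset 𝒫
    ... | 𝒫𝒫 , 𝒫𝒫-spec
      with comprehension
        (∃ᵈ ∃ᵈ (1F ∈ᵈ 3F ×ᵈ 0F ∈ᵈ 4F ×ᵈ pairᵈ 2F 1F 0F)) (A ∷ B ∷ []) 𝒫𝒫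
    ... | C , C-spec = C , λ p → mk⇔ (λ p∈C → proj₂ (to (C-spec p) p∈C))
                         λ p∈A×B → from (C-spec p) (bounded p p∈A×B , p∈A×B)
      where
      unordered∈𝒫 : ∀ {x y} → x ∈ A ⊎ x ∈ B → y ∈ A ⊎ y ∈ B → unordered x y ∈ 𝒫
      unordered∈𝒫 x∈ y∈ = from (𝒫-spec _) λ z z∈ →
        [ (λ { refl → from ∈-∪ x∈ }) , (λ { refl → from ∈-∪ y∈ }) ]′
          (to ∈-unordered z∈)
      bounded : ∀ p → (⌜ A ⌝ ⊗ ⌜ B ⌝) p → p ∈ 𝒫𝒫
      bounded _ (x , y , x∈A , y∈B , refl) = from (𝒫𝒫-spec _) λ z z∈ →
        [ (λ { refl → unordered∈𝒫 (inj₁ x∈A) (inj₁ x∈A) })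
        , (λ { refl → unordered∈𝒫 (inj₁ x∈A) (inj₂ y∈B) }) ]′ (to ∈-unordered z∈)

    -- P receives the pair ⟨x,y⟩ itself as a third argument, which saves
    -- weakening the formula that defines it.
    relation : ∀ {n} {P : Vec V (suc (suc (suc n))) → Set ℓ} → Definable P →
      ∀ ρ A B → ∃ λ r → ⌜ r ⌝ ⊆ ⌜ A ⌝ ⊗ ⌜ B ⌝ ×
        (∀ x y → ⟨ x , y ⟩ ∈ r ⇔ (x ∈ A × y ∈ B × P (y ∷ x ∷ ⟨ x , y ⟩ ∷ ρ)))
    relation {P = P} P-def ρ A B with product A B
    ... | C , C-spec
      with comprehension (∃ᵈ ∃ᵈ (pairᵈ 2F 1F 0F ×ᵈ P-def)) ρ C
    ... | r , r-spec = r , (λ {p} p∈r → to (C-spec p) (proj₁ (to (r-spec p) p∈r)))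
                         , λ x y → mk⇔ (r⁻ x y) (r⁺ x y)
      where
      r⁻ : ∀ x y → ⟨ x , y ⟩ ∈ r → x ∈ A × y ∈ B × P (y ∷ x ∷ ⟨ x , y ⟩ ∷ ρ)
      r⁻ x y p∈r with to (r-spec _) p∈r
      ... | p∈C , x₁ , y₁ , eq₁ , Pp with to (C-spec _) p∈C
      ... | x₂ , y₂ , x₂∈A , y₂∈B , eq₂ with pair-injective eq₁ | pair-injective eq₂
      ... | refl , refl | refl , refl = x₂∈A , y₂∈B , Pp
      r⁺ : ∀ x y → x ∈ A × y ∈ B × P (y ∷ x ∷ ⟨ x , y ⟩ ∷ ρ) → ⟨ x , y ⟩ ∈ r
      r⁺ x y (x∈A , y∈B , Pp) = from (r-spec _)
        (from (C-spec _) (x , y , x∈A , y∈B , refl) , x , y , refl , Pp)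

  -- Natural numbers

  opaque
    𝐬 : V → V
    𝐬 n = n ∪❴ n ❵

    ∈-𝐬 : ∀ {m n} → m ∈ 𝐬 n ⇔ (m ∈ n ⊎ m ≡ n)
    ∈-𝐬 = ∈-∪❴❵

  n∈𝐬n : ∀ {n} → n ∈ 𝐬 n
  n∈𝐬n = from ∈-𝐬 (inj₂ refl)

  𝐬-isSuccessor : ∀ n → IsSuccessor n (𝐬 n)
  𝐬-isSuccessor n z = ∈-𝐬

  isSuccessor⇒≡𝐬 : ∀ {n s} → IsSuccessor n s → s ≡ 𝐬 n
  isSuccessor⇒≡𝐬 n⇒s = extensionality _ _ λ z → ⇔-sym ∈-𝐬 ⇔-∘ n⇒s z

  ω-spec : ∀ {x} → x ∈ ω ⇔ (x ∈ proj₁ infinity × (∀ v → IsInductive v → x ∈ v))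
  ω-spec {x} = proj₂ least-inductive x

  inductive-∅ : ∀ {v} → IsInductive v → ∅ ∈ v
  inductive-∅ ((e , e-empty , e∈v) , _) =
    subst (_∈ _) (≡-ext (λ z z∈e → ⊥-elim (e-empty z z∈e)) λ z z∈∅ → ⊥-elim (∉∅ z∈∅)) e∈v

  inductive-𝐬 : ∀ {v n} → IsInductive v → n ∈ v → 𝐬 n ∈ v
  inductive-𝐬 (_ , v-suc) n∈v with v-suc _ n∈v
  ... | s , n⇒s , s∈v = subst (_∈ _) (isSuccessor⇒≡𝐬 n⇒s) s∈v

  ∅∈ω : ∅ ∈ ω
  ∅∈ω = from ω-spec
    (inductive-∅ (proj₂ infinity) , λ v v-ind → inductive-∅ v-ind)

  𝐬∈ω : ∀ {n} → n ∈ ω → 𝐬 n ∈ ω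
  𝐬∈ω n∈ω = from ω-spec
    ( inductive-𝐬 (proj₂ infinity) (proj₁ (to ω-spec n∈ω))
    , λ v v-ind → inductive-𝐬 v-ind (proj₂ (to ω-spec n∈ω) v v-ind))

  opaque
    -- The elements of `ω` with `P` form an inductive set, and `ω` is contained in each of those.
    ω-induction : ∀ {n} {P : Vec V (suc n) → Set ℓ} → Definable P → ∀ ρ →
      P (∅ ∷ ρ) → (∀ n → n ∈ ω → P (n ∷ ρ) → P (𝐬 n ∷ ρ)) →
      ∀ n → n ∈ ω → P (n ∷ ρ)
    ω-induction P-def ρ P∅ P𝐬 n n∈ω with comprehension P-def ρ ω
    ... | b , b-spec = proj₂ (to (b-spec n) (proj₂ (to ω-spec n∈ω) b b-inductive))
      where
      b-inductive : IsInductive b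
      b-inductive = (∅ , (λ z → ∉∅) , from (b-spec ∅) (∅∈ω , P∅)) ,
        λ m m∈b → let (m∈ω , Pm) = to (b-spec m) m∈b in
          𝐬 m , 𝐬-isSuccessor m , from (b-spec (𝐬 m)) (𝐬∈ω m∈ω , P𝐬 m m∈ω Pm)

    -- The order of ω is ∈.

    ∈-ω : ∀ {m n} → m ∈ n → n ∈ ω → m ∈ ω
    ∈-ω {m} {n} m∈n n∈ω = ω-induction (∀ᵈ (0F ∈ᵈ 1F →ᵈ 0F ∈ᵈ 2F)) (ω ∷ [])
      (λ _ m∈∅ → ⊥-elim (∉∅ m∈∅))
      (λ n n∈ω ih m m∈𝐬n → [ ih m , (λ { refl → n∈ω }) ]′ (to ∈-𝐬 m∈𝐬n))
      n n∈ω m m∈n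

    <-trans : ∀ {k m n} → n ∈ ω → k ∈ m → m ∈ n → k ∈ n
    <-trans {k} {m} {n} n∈ω k∈m m∈n = ω-induction
      (∀ᵈ (0F ∈ᵈ 1F →ᵈ ∀ᵈ (0F ∈ᵈ 1F →ᵈ 0F ∈ᵈ 2F))) []
      (λ _ m∈∅ → ⊥-elim (∉∅ m∈∅))
      (λ n n∈ω ih m m∈𝐬n k k∈m → from ∈-𝐬 (inj₁
        ([ (λ m∈n → ih m m∈n k k∈m) , (λ { refl → k∈m }) ]′ (to ∈-𝐬 m∈𝐬n))))
      n n∈ω m m∈n k k∈m

    <-asym : ∀ {m n} → n ∈ ω → m ∈ n → ¬ (n ∈ m)
    <-asym n∈ω m∈n n∈m = x∉x (<-trans n∈ω n∈m m∈n)

    ∅-least : ∀ {n} → n ∈ ω → ∅ ≡ n ⊎ ∅ ∈ n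
    ∅-least {n} n∈ω = ω-induction (1F ≡ᵈ 0F ⊎ᵈ 1F ∈ᵈ 0F) (∅ ∷ []) (inj₁ refl)
      (λ n _ ih → inj₂ (from ∈-𝐬 ([ inj₂ , inj₁ ]′ ih))) n n∈ω

    ∅∈-nonempty : ∀ {m n} → n ∈ ω → m ∈ n → ∅ ∈ n
    ∅∈-nonempty n∈ω m∈n = [ (λ { refl → ⊥-elim (∉∅ m∈n) }) , id ]′ (∅-least n∈ω)

    𝐬-≤ : ∀ {m n} → n ∈ ω → m ∈ n → 𝐬 m ∈ n ⊎ 𝐬 m ≡ n
    𝐬-≤ {m} {n} n∈ω m∈n = ω-induction
      (1F ∈ᵈ 0F →ᵈ 2F ∈ᵈ 0F ⊎ᵈ 2F ≡ᵈ 0F) (m ∷ 𝐬 m ∷ [])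
      (λ m∈∅ → ⊥-elim (∉∅ m∈∅))
      (λ n _ ih m∈𝐬n →
        [ (λ m∈n → inj₁ (from ∈-𝐬 (ih m∈n))) , (λ { refl → inj₂ refl }) ]′ (to ∈-𝐬 m∈𝐬n))
      n n∈ω m∈n

    <-cmp : ∀ {m n} → m ∈ ω → n ∈ ω → m ∈ n ⊎ m ≡ n ⊎ n ∈ m
    <-cmp {m} {n} m∈ω n∈ω = ω-induction
      (1F ∈ᵈ 0F ⊎ᵈ 1F ≡ᵈ 0F ⊎ᵈ 0F ∈ᵈ 1F) (m ∷ [])
      ([ (λ eq → inj₂ (inj₁ (sym eq))) , inj₂ ∘ inj₂ ]′ (∅-least m∈ω))
      (λ { n _ (inj₁ m∈n)        → inj₁ (from ∈-𝐬 (inj₁ m∈n))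
         ; n _ (inj₂ (inj₁ m≡n)) → inj₁ (from ∈-𝐬 (inj₂ m≡n))
         ; n _ (inj₂ (inj₂ n∈m)) → inj₂ ([ inj₂ , inj₁ ∘ sym ]′ (𝐬-≤ m∈ω n∈m)) })
      n n∈ω

    𝐬-injective : ∀ {m n} → n ∈ ω → 𝐬 m ≡ 𝐬 n → m ≡ n
    𝐬-injective {m} {n} n∈ω eq
      with to ∈-𝐬 (subst (m ∈_) eq n∈𝐬n) | to ∈-𝐬 (subst (n ∈_) (sym eq) n∈𝐬n)
    ... | inj₂ m≡n | _        = m≡n
    ... | inj₁ _   | inj₂ n≡m = sym n≡m
    ... | inj₁ m∈n | inj₁ n∈m = ⊥-elim (<-asym n∈ω m∈n n∈m)

  opaque
    strict-upper-bound : ∀ {m n} → m ∈ ω → n ∈ ω → ∃ λ k → k ∈ ω × m ∈ k × n ∈ k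
    strict-upper-bound {m} {n} m∈ω n∈ω with <-cmp m∈ω n∈ω
    ... | inj₁ m∈n         = 𝐬 n , 𝐬∈ω n∈ω , from ∈-𝐬 (inj₁ m∈n) , n∈𝐬n
    ... | inj₂ (inj₁ refl) = 𝐬 n , 𝐬∈ω n∈ω , n∈𝐬n , n∈𝐬n
    ... | inj₂ (inj₂ n∈m)  = 𝐬 m , 𝐬∈ω m∈ω , n∈𝐬n , from ∈-𝐬 (inj₁ n∈m)

    -- Foundation gives an ∈-minimal element of the set of witnesses, and ∈ is the order of `ω`.
    least : ∀ {n} {P : Vec V (suc n) → Set ℓ} → Definable P → ∀ ρ →
      ∀ n → n ∈ ω → P (n ∷ ρ) →
      ∃ λ m → m ∈ ω × P (m ∷ ρ) × (∀ k → k ∈ m → ¬ P (k ∷ ρ))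
    least P-def ρ n n∈ω Pn with comprehension P-def ρ ω
    ... | b , b-spec with foundation b (n , from (b-spec n) (n∈ω , Pn))
    ... | m , m∈b , m-min with to (b-spec m) m∈b
    ... | m∈ω , Pm = m , m∈ω , Pm , λ k k∈m Pk →
      m-min k k∈m (from (b-spec k) (∈-ω k∈m m∈ω , Pk))

    strong-induction : ∀ {n} {P : Vec V (suc n) → Set ℓ} → Definable P → ∀ ρ →
      (∀ n → n ∈ ω → (∀ m → m ∈ n → P (m ∷ ρ)) → P (n ∷ ρ)) →
      ∀ n → n ∈ ω → P (n ∷ ρ)
    strong-induction P-def ρ step n n∈ω = dne λ ¬Pn →
      let (m , m∈ω , ¬Pm , m-min) = least (¬ᵈ P-def) ρ n n∈ω ¬Pn in
      ¬Pm (step m m∈ω λ k k∈m → dne (m-min k k∈m))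

  -- Bounded and unbounded subsets of ω

  ∶⟶-pair : ∀ {f P Q x y} → f ∶ P ⟶ Q → ⟨ x , y ⟩ ∈ f → P x × Q y
  ∶⟶-pair f-fun p∈f with _∶_⟶_.graph f-fun p∈f
  ... | _ , _ , Px , Qy , eq with pair-injective eq
  ... | refl , refl = Px , Qy

  -- No domain is prescribed: the maps to which this is applied, such as the inverse of an
  -- injection, may be partial.
  Functional : V → Set ℓ
  Functional g = ∀ k i j → ⟨ k , i ⟩ ∈ g → ⟨ k , j ⟩ ∈ g → i ≡ j

  opaque
    bounded-image : ∀ {g n} → Functional g → n ∈ ω →
      ∃ λ m → m ∈ ω × (∀ k → k ∈ n → ∀ j → j ∈ ω → ⟨ k , j ⟩ ∈ g → j ∈ m)
    bounded-image {g} {n} g-fun n∈ω = ω-induction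
      (∃ᵈ (0F ∈ᵈ 2F ×ᵈ ∀ᵈ (0F ∈ᵈ 2F →ᵈ ∀ᵈ (0F ∈ᵈ 4F →ᵈ ⟨ 1F , 0F ⟩∈ᵈ 5F →ᵈ 0F ∈ᵈ 2F))))
      (ω ∷ g ∷ []) (∅ , ∅∈ω , λ _ k∈∅ → ⊥-elim (∉∅ k∈∅)) step n n∈ω
      where
      step : ∀ n → n ∈ ω →
        (∃ λ m → m ∈ ω × (∀ k → k ∈ n → ∀ j → j ∈ ω → ⟨ k , j ⟩ ∈ g → j ∈ m)) →
        ∃ λ m → m ∈ ω × (∀ k → k ∈ 𝐬 n → ∀ j → j ∈ ω → ⟨ k , j ⟩ ∈ g → j ∈ m)
      step n n∈ω (m , m∈ω , m-bound) with em {P = ∃ λ i → i ∈ ω × ⟨ n , i ⟩ ∈ g}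
      ... | no ¬gn = m , m∈ω , λ k k∈𝐬n j j∈ω p → [ (λ k∈n → m-bound k k∈n j j∈ω p)
            , (λ { refl → ⊥-elim (¬gn (j , j∈ω , p)) }) ]′ (to ∈-𝐬 k∈𝐬n)
      ... | yes (i , i∈ω , gn) with strict-upper-bound m∈ω i∈ω
      ... | l , l∈ω , m∈l , i∈l = l , l∈ω , λ k k∈𝐬n j j∈ω p →
            [ (λ k∈n → <-trans l∈ω (m-bound k k∈n j j∈ω p) m∈l)
            , (λ { refl → subst (_∈ l) (g-fun n i j gn p) i∈l }) ]′ (to ∈-𝐬 k∈𝐬n)

  opaque
    -- A pigeonhole principle without counting: the inverse of `f` is a partial function on `n`, so
    -- its values have a strict bound `m`; but `m` is itself one of them.
    no-injection : ∀ {f n} → n ∈ ω → IsInjective f →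
      ¬ (∀ k → k ∈ ω → ∃ λ c → c ∈ n × ⟨ k , c ⟩ ∈ f)
    no-injection {f} {n} n∈ω f-inj f-total with relation (⟨ 0F , 1F ⟩∈ᵈ 3F) (f ∷ []) n ω
    ... | g , _ , g-spec
      with bounded-image {g} (λ c i j p q → f-inj i j c (proj₂ (proj₂ (to (g-spec c i) p)))
                                               (proj₂ (proj₂ (to (g-spec c j) q)))) n∈ω
    ... | m , m∈ω , m-bound with f-total m m∈ω
    ... | c , c∈n , p = x∉x (m-bound c c∈n m m∈ω (from (g-spec c m) (c∈n , m∈ω , p)))

  Unbounded : V → Set ℓ
  Unbounded x = ∀ n → n ∈ ω → ∃ λ m → n ∈ m × m ∈ x

  BoundedBy : V → Class → Set ℓ
  BoundedBy n P = ∀ x → P x → x ∈ n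

  opaque
    ¬unbounded⇒bounded : ∀ {x} → ⌜ x ⌝ ⊆ ⌜ ω ⌝ → ¬ Unbounded x →
                         ∃ λ n → n ∈ ω × BoundedBy n ⌜ x ⌝
    ¬unbounded⇒bounded x⊆ω ¬unb = dne λ ¬bdd → ¬unb λ n n∈ω → dne λ n-bound →
      ¬bdd (𝐬 n , 𝐬∈ω n∈ω , λ m m∈x → below n∈ω (x⊆ω m∈x) λ n∈m → n-bound (m , n∈m , m∈x))
      where
      below : ∀ {m n} → n ∈ ω → m ∈ ω → ¬ (n ∈ m) → m ∈ 𝐬 n
      below n∈ω m∈ω n∉m with <-cmp m∈ω n∈ω
      ... | inj₁ m∈n        = from ∈-𝐬 (inj₁ m∈n)
      ... | inj₂ (inj₁ m≡n) = from ∈-𝐬 (inj₂ m≡n)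
      ... | inj₂ (inj₂ n∈m) = ⊥-elim (n∉m n∈m)

    finite⇒bounded : ∀ {P} → P ⊆ ⌜ ω ⌝ → Finite P → ∃ λ n → n ∈ ω × BoundedBy n P
    finite⇒bounded P⊆ω (n , n∈ω , f , f-fun , _ , f-onto)
      with bounded-image {f} (_∶_⟶_.unique f-fun) n∈ω
    ... | m , m∈ω , m-bound = m , m∈ω , λ x Px → let (k , p) = f-onto x Px in
      m-bound k (proj₁ (∶⟶-pair f-fun p)) x (P⊆ω Px) p

    countablyInfinite⇒unbounded : ∀ {x} → ⌜ x ⌝ ⊆ ⌜ ω ⌝ →
                                  CountablyInfinite ⌜ x ⌝ → Unbounded x
    countablyInfinite⇒unbounded {x} x⊆ω (f , f-fun , f-inj , _) = dne λ ¬unb →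
      let (n , n∈ω , bdd) = ¬unbounded⇒bounded x⊆ω ¬unb in
      no-injection n∈ω f-inj λ k k∈ω →
        let (c , c∈x , p) = _∶_⟶_.total f-fun k k∈ω in c , bdd c c∈x , p

  -- Finite sets

  opaque
    functionᵈ : ∀ {n} (f a b : Fin n) →
      Definable (λ ρ → lookup ρ f ∶ ⌜ lookup ρ a ⌝ ⟶ ⌜ lookup ρ b ⌝)
    functionᵈ f a b = mapᵈ
      ( ∀ᵈ (0F ∈ᵈ suc f →ᵈ
          ∃ᵈ ∃ᵈ (1F ∈ᵈ suc (suc (suc a)) ×ᵈ 0F ∈ᵈ suc (suc (suc b)) ×ᵈ pairᵈ 2F 1F 0F))
      ×ᵈ ∀ᵈ (0F ∈ᵈ suc a →ᵈ
          ∃ᵈ (0F ∈ᵈ suc (suc b) ×ᵈ ⟨ 1F , 0F ⟩∈ᵈ suc (suc f)))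
      ×ᵈ ∀ᵈ ∀ᵈ ∀ᵈ (⟨ 2F , 1F ⟩∈ᵈ suc (suc (suc f)) →ᵈ ⟨ 2F , 0F ⟩∈ᵈ suc (suc (suc f)) →ᵈ
          1F ≡ᵈ 0F))
      (λ ρ → mk⇔
        (λ (gr , tot , uni) → record { graph = λ {p} → gr p ; total = tot ; unique = uni })
        λ F → (λ p → _∶_⟶_.graph F) , _∶_⟶_.total F , _∶_⟶_.unique F)

    bijectionᵈ : ∀ {n} (a b : Fin n) →
      Definable (λ ρ → Bijection ⌜ lookup ρ a ⌝ ⌜ lookup ρ b ⌝)
    bijectionᵈ a b = ∃ᵈ (functionᵈ 0F (suc a) (suc b)
      ×ᵈ ∀ᵈ ∀ᵈ ∀ᵈ (⟨ 2F , 0F ⟩∈ᵈ 3F →ᵈ ⟨ 1F , 0F ⟩∈ᵈ 3F →ᵈ 2F ≡ᵈ 1F)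
      ×ᵈ ∀ᵈ (0F ∈ᵈ suc (suc b) →ᵈ ∃ᵈ (⟨ 0F , 1F ⟩∈ᵈ 2F)))

  finite-resp-≐ : ∀ {P Q} → P ⊆ Q → Q ⊆ P → Finite P → Finite Q
  finite-resp-≐ P⊆Q Q⊆P (n , n∈ω , f , f-fun , f-inj , f-onto) =
    n , n∈ω , f , f-fun′ , f-inj , λ y Qy → f-onto y (Q⊆P Qy)
    where
    open _∶_⟶_ f-fun
    f-fun′ = record
      { graph  = λ p∈f → let (x , y , x∈n , Py , eq) = graph p∈f in x , y , x∈n , P⊆Q Py , eq
      ; total  = λ x x∈n → let (y , Py , p∈f) = total x x∈n in y , P⊆Q Py , p∈f
      ; unique = unique }

  finite-∅ : Finite ⌜ ∅ ⌝
  finite-∅ = ∅ , ∅∈ω , ∅ , record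
    { graph  = λ p∈∅ → ⊥-elim (∉∅ p∈∅)
    ; total  = λ x x∈∅ → ⊥-elim (∉∅ x∈∅)
    ; unique = λ x y z p∈∅ → ⊥-elim (∉∅ p∈∅) }
    , (λ x y z p∈∅ → ⊥-elim (∉∅ p∈∅)) , λ y y∈∅ → ⊥-elim (∉∅ y∈∅)

  finite-∪❴❵ : ∀ {s x} → Finite ⌜ s ⌝ → Finite ⌜ s ∪❴ x ❵ ⌝
  finite-∪❴❵ {s} {x} fin@(n , n∈ω , f , f-fun , f-inj , f-onto) with em {P = x ∈ s}
  ... | yes x∈s = finite-resp-≐ (λ z∈s → from ∈-∪❴❵ (inj₁ z∈s))
    (λ z∈ → [ id , (λ { refl → x∈s }) ]′ (to ∈-∪❴❵ z∈)) fin
  ... | no x∉s = 𝐬 n , 𝐬∈ω n∈ω , f′ , f′-fun , f′-inj , f′-onto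
    where
    open _∶_⟶_ f-fun
    f′ = f ∪❴ ⟨ n , x ⟩ ❵
    old : ∀ {a b} → ⟨ a , b ⟩ ∈ f → a ∈ n × b ∈ s
    old = ∶⟶-pair f-fun
    f′⁻ : ∀ {a b} → ⟨ a , b ⟩ ∈ f′ → ⟨ a , b ⟩ ∈ f ⊎ (a ≡ n × b ≡ x)
    f′⁻ p = [ inj₁ , inj₂ ∘ pair-injective ]′ (to ∈-∪❴❵ p)
    f′-fun : f′ ∶ ⌜ 𝐬 n ⌝ ⟶ ⌜ s ∪❴ x ❵ ⌝
    f′-fun = record { graph = graph′ ; total = total′ ; unique = unique′ }
      where
      graph′ : ⌜ f′ ⌝ ⊆ ⌜ 𝐬 n ⌝ ⊗ ⌜ s ∪❴ x ❵ ⌝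
      graph′ p∈f′ with to ∈-∪❴❵ p∈f′
      ... | inj₁ p∈f with graph p∈f
      ... | a , b , a∈n , b∈s , eq =
        a , b , from ∈-𝐬 (inj₁ a∈n) , from ∈-∪❴❵ (inj₁ b∈s) , eq
      graph′ p∈f′ | inj₂ eq = n , x , n∈𝐬n , from ∈-∪❴❵ (inj₂ refl) , eq
      total′ : ∀ a → a ∈ 𝐬 n → ∃ λ b → b ∈ (s ∪❴ x ❵) × ⟨ a , b ⟩ ∈ f′
      total′ a a∈𝐬n with to ∈-𝐬 a∈𝐬n
      ... | inj₂ refl = x , from ∈-∪❴❵ (inj₂ refl) , from ∈-∪❴❵ (inj₂ refl)
      ... | inj₁ a∈n with total a a∈n
      ... | b , b∈s , p = b , from ∈-∪❴❵ (inj₁ b∈s) , from ∈-∪❴❵ (inj₁ p)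
      unique′ : Functional f′
      unique′ a b c p q with f′⁻ p | f′⁻ q
      ... | inj₁ p₁            | inj₁ q₁            = unique a b c p₁ q₁
      ... | inj₁ p₁            | inj₂ (refl , _)    = ⊥-elim (x∉x (proj₁ (old p₁)))
      ... | inj₂ (refl , _)    | inj₁ q₁            = ⊥-elim (x∉x (proj₁ (old q₁)))
      ... | inj₂ (refl , refl) | inj₂ (refl , refl) = refl
    f′-inj : IsInjective f′
    f′-inj a b c p q with f′⁻ p | f′⁻ q
    ... | inj₁ p₁            | inj₁ q₁            = f-inj a b c p₁ q₁
    ... | inj₁ p₁            | inj₂ (_ , refl)    = ⊥-elim (x∉s (proj₂ (old p₁)))
    ... | inj₂ (_ , refl)    | inj₁ q₁            = ⊥-elim (x∉s (proj₂ (old q₁)))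
    ... | inj₂ (refl , refl) | inj₂ (refl , refl) = refl
    f′-onto : IsOnto f′ ⌜ s ∪❴ x ❵ ⌝
    f′-onto b b∈ with to ∈-∪❴❵ b∈
    ... | inj₂ refl = n , from ∈-∪❴❵ (inj₂ refl)
    ... | inj₁ b∈s with f-onto b b∈s
    ... | a , p = a , from ∈-∪❴❵ (inj₁ p)

  opaque
    -- Formulas have no constants, so `ω` enters as the value of the variable `w`.
    finiteᵈ : ∀ {n} (w s : Fin n) →
      Definable (λ ρ → ∃ λ m → m ∈ lookup ρ w × Bijection ⌜ m ⌝ ⌜ lookup ρ s ⌝)
    finiteᵈ w s = ∃ᵈ (0F ∈ᵈ suc w ×ᵈ bijectionᵈ 0F (suc s))

  -- Induction on the bound, for all sets simultaneously: a set bounded by `𝐬 n` is its part below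
  -- `n`, possibly with `n` added.
  bounded⇒finite : ∀ {n x} → n ∈ ω → BoundedBy n ⌜ x ⌝ → Finite ⌜ x ⌝
  bounded⇒finite {n} {x} n∈ω bdd = ω-induction
    (∀ᵈ (∀ᵈ (0F ∈ᵈ 1F →ᵈ 0F ∈ᵈ 2F) →ᵈ finiteᵈ 2F 0F)) (ω ∷ [])
    (λ t bdd → finite-resp-≐ (λ z∈∅ → ⊥-elim (∉∅ z∈∅)) (λ {z} → bdd z) finite-∅)
    step n n∈ω x bdd
    where
    step : ∀ n → n ∈ ω → (∀ t → BoundedBy n ⌜ t ⌝ → Finite ⌜ t ⌝) →
           ∀ t → BoundedBy (𝐬 n) ⌜ t ⌝ → Finite ⌜ t ⌝
    step n n∈ω ih t bdd with comprehension (0F ∈ᵈ 1F) (n ∷ []) t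
    ... | t′ , t′-spec with ih t′ (λ z z∈t′ → proj₂ (to (t′-spec z) z∈t′)) | em {P = n ∈ t}
    ... | fin | no n∉t = finite-resp-≐
      (λ {z} z∈t′ → proj₁ (to (t′-spec z) z∈t′))
      (λ {z} z∈t → from (t′-spec z) (z∈t ,
        [ id , (λ { refl → ⊥-elim (n∉t z∈t) }) ]′ (to ∈-𝐬 (bdd z z∈t)))) fin
    ... | fin | yes n∈t = finite-resp-≐
      (λ {z} z∈ → [ (λ z∈t′ → proj₁ (to (t′-spec z) z∈t′)) , (λ { refl → n∈t }) ]′
                     (to ∈-∪❴❵ z∈))
      (λ {z} z∈t → from ∈-∪❴❵
        ([ (λ z∈n → inj₁ (from (t′-spec z) (z∈t , z∈n))) , inj₂ ]′ (to ∈-𝐬 (bdd z z∈t))))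
      (finite-∪❴❵ {t′} {n} fin)

  -- Enumerating unbounded sets

  -- The increasing enumeration of `z`, obtained by an instance of the recursion theorem inside `𝕍`.
  unbounded⇒countablyInfinite : ∀ {z} → ⌜ z ⌝ ⊆ ⌜ ω ⌝ → Unbounded z →
                                CountablyInfinite ⌜ z ⌝
  unbounded⇒countablyInfinite {z} z⊆ω unb
    -- The data of the recursion: the first element `c₀` of `z`, the successor graph `σ` on `ω`, and
    -- the relation `N` from each element of `z` to the next one.
    with least (0F ∈ᵈ 1F) (z ∷ []) _ (z⊆ω (proj₂ (proj₂ (unb ∅ ∅∈ω)))) (proj₂ (proj₂ (unb ∅ ∅∈ω)))
       | relation (∀ᵈ (0F ∈ᵈ 1F ⇔ᵈ 0F ∈ᵈ 2F ⊎ᵈ 0F ≡ᵈ 2F)) [] ω ω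
       | relation (1F ∈ᵈ 0F ×ᵈ ∀ᵈ (0F ∈ᵈ 4F →ᵈ 2F ∈ᵈ 0F →ᵈ ¬ᵈ (0F ∈ᵈ 1F))) (z ∷ []) z z
  ... | c₀ , c₀∈ω , c₀∈z , c₀-min | σ , _ , σ-spec | N , _ , N-spec
    with relation
      -- The graph `h` consists of the pairs that lie in every set containing `⟨ ∅ , c₀ ⟩` and
      -- closed under passing from `⟨ n , a ⟩` to the successor of `n` and the `N`-successor of `a`.
      (∀ᵈ (4F ∈ᵈ 0F ×ᵈ
           ∀ᵈ ∀ᵈ ∀ᵈ ∀ᵈ (⟨ 3F , 2F ⟩∈ᵈ 4F →ᵈ ⟨ 3F , 1F ⟩∈ᵈ 9F →ᵈ ⟨ 2F , 0F ⟩∈ᵈ suc 9F →ᵈ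
                        ⟨ 1F , 0F ⟩∈ᵈ 4F)
         →ᵈ 3F ∈ᵈ 0F))
      (⟨ ∅ , c₀ ⟩ ∷ σ ∷ N ∷ []) ω z
  ... | h , h⊆ , h-spec = h , h-fun , h-inj , h-onto
    where
    Closed : V → Set ℓ
    Closed W = ⟨ ∅ , c₀ ⟩ ∈ W ×
      (∀ n a s b → ⟨ n , a ⟩ ∈ W → ⟨ n , s ⟩ ∈ σ → ⟨ a , b ⟩ ∈ N → ⟨ s , b ⟩ ∈ W)

    h-closed : Closed h
    h-closed = from (h-spec ∅ c₀) (∅∈ω , c₀∈z , λ W → proj₁) ,
      λ n a s b p∈h n⇒s a⇒b → from (h-spec s b)
        ( proj₁ (proj₂ (to (σ-spec n s) n⇒s)) , proj₁ (proj₂ (to (N-spec a b) a⇒b))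
        , λ W W-closed → proj₂ W-closed n a s b
            (proj₂ (proj₂ (to (h-spec n a) p∈h)) W W-closed) n⇒s a⇒b)

    σ⁺ : ∀ {n} → n ∈ ω → ⟨ n , 𝐬 n ⟩ ∈ σ
    σ⁺ {n} n∈ω = from (σ-spec n (𝐬 n)) (n∈ω , 𝐬∈ω n∈ω , 𝐬-isSuccessor n)

    next : ∀ {a} → a ∈ z → ∃ λ b → ⟨ a , b ⟩ ∈ N
    next {a} a∈z with unb a (z⊆ω a∈z)
    ... | m , a∈m , m∈z
      with least (0F ∈ᵈ 1F ×ᵈ 2F ∈ᵈ 0F) (z ∷ a ∷ []) m (z⊆ω m∈z) (m∈z , a∈m)
    ... | b , _ , (b∈z , a∈b) , b-min =
      b , from (N-spec a b) (a∈z , b∈z , a∈b , λ c c∈z a∈c c∈b → b-min c c∈b (c∈z , a∈c))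

    h-total : ∀ n → n ∈ ω → ∃ λ a → ⟨ n , a ⟩ ∈ h
    h-total = ω-induction (∃ᵈ ⟨ 1F , 0F ⟩∈ᵈ 2F) (h ∷ []) (c₀ , proj₁ h-closed)
      λ n n∈ω (a , p) → let (b , a⇒b) = next (proj₁ (proj₂ (to (h-spec n a) p))) in
        b , proj₂ h-closed n a (𝐬 n) b p (σ⁺ n∈ω) a⇒b

    Successor : V → V → Set ℓ
    Successor s b = ∃₂ λ n a → n ∈ ω × s ≡ 𝐬 n × ⟨ n , a ⟩ ∈ h × ⟨ a , b ⟩ ∈ N

    -- The pairs of h with a predecessor in h, together with ⟨∅,c₀⟩, are closed.
    h-inversion : ∀ {m c} → ⟨ m , c ⟩ ∈ h → (m ≡ ∅ × c ≡ c₀) ⊎ Successor m c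
    h-inversion {m} {c} mc∈h with comprehension
      (0F ≡ᵈ 1F ⊎ᵈ ∃ᵈ ∃ᵈ ∃ᵈ ∃ᵈ (⟨ 3F , 2F ⟩∈ᵈ 6F ×ᵈ ⟨ 3F , 1F ⟩∈ᵈ 7F ×ᵈ ⟨ 2F , 0F ⟩∈ᵈ 8F ×ᵈ
                                pairᵈ 4F 1F 0F))
      (⟨ ∅ , c₀ ⟩ ∷ h ∷ σ ∷ N ∷ []) h
    ... | W , W-spec = [ inj₁ ∘ pair-injective , inj₂ ∘ successor ]′
        (proj₂ (to (W-spec ⟨ m , c ⟩) (proj₂ (proj₂ (to (h-spec m c) mc∈h)) W W-closed)))
      where
      W-closed : Closed W
      W-closed = from (W-spec _) (proj₁ h-closed , inj₁ refl) ,
        λ n a s b p∈W n⇒s a⇒b → let p∈h = proj₁ (to (W-spec _) p∈W) in from (W-spec _)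
          ( proj₂ h-closed n a s b p∈h n⇒s a⇒b
          , inj₂ (n , a , s , b , p∈h , n⇒s , a⇒b , refl))
      successor : _ → Successor m c
      successor (n , a , s , b , p∈h , n⇒s , a⇒b , eq) with pair-injective eq
      ... | refl , refl = n , a , proj₁ (to (σ-spec n s) n⇒s)
        , isSuccessor⇒≡𝐬 (proj₂ (proj₂ (to (σ-spec n s) n⇒s))) , p∈h , a⇒b

    N-functional : ∀ {a b c} → ⟨ a , b ⟩ ∈ N → ⟨ a , c ⟩ ∈ N → b ≡ c
    N-functional {a} {b} {c} p q with to (N-spec a b) p | to (N-spec a c) q
    ... | _ , b∈z , a∈b , b-min | _ , c∈z , a∈c , c-min with <-cmp (z⊆ω b∈z) (z⊆ω c∈z)
    ... | inj₁ b∈c        = ⊥-elim (c-min b b∈z a∈b b∈c)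
    ... | inj₂ (inj₁ eq)  = eq
    ... | inj₂ (inj₂ c∈b) = ⊥-elim (b-min c c∈z a∈c c∈b)

    N-injective : ∀ {a b c} → ⟨ a , c ⟩ ∈ N → ⟨ b , c ⟩ ∈ N → a ≡ b
    N-injective {a} {b} {c} p q with to (N-spec a c) p | to (N-spec b c) q
    ... | a∈z , _ , a∈c , a-min | b∈z , _ , b∈c , b-min with <-cmp (z⊆ω a∈z) (z⊆ω b∈z)
    ... | inj₁ a∈b        = ⊥-elim (a-min b b∈z a∈b b∈c)
    ... | inj₂ (inj₁ eq)  = eq
    ... | inj₂ (inj₂ b∈a) = ⊥-elim (b-min a a∈z b∈a a∈c)

    ¬N-c₀ : ∀ {a} → ¬ (⟨ a , c₀ ⟩ ∈ N)
    ¬N-c₀ {a} p = let (a∈z , _ , a∈c₀ , _) = to (N-spec a c₀) p in c₀-min a a∈c₀ a∈z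

    𝐬≢∅ : ∀ {n} → ¬ (𝐬 n ≡ ∅)
    𝐬≢∅ {n} eq = ∉∅ (subst (n ∈_) eq n∈𝐬n)

    h-functional : ∀ n → n ∈ ω → ∀ a b → ⟨ n , a ⟩ ∈ h → ⟨ n , b ⟩ ∈ h → a ≡ b
    h-functional = ω-induction
      (∀ᵈ ∀ᵈ (⟨ 2F , 1F ⟩∈ᵈ 3F →ᵈ ⟨ 2F , 0F ⟩∈ᵈ 3F →ᵈ 1F ≡ᵈ 0F)) (h ∷ []) base step
      where
      base : ∀ a b → ⟨ ∅ , a ⟩ ∈ h → ⟨ ∅ , b ⟩ ∈ h → a ≡ b
      base a b p q with h-inversion p | h-inversion q
      ... | inj₁ (_ , refl)            | inj₁ (_ , refl)            = refl
      ... | inj₂ (_ , _ , _ , eq , _)  | _                          = ⊥-elim (𝐬≢∅ (sym eq))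
      ... | inj₁ _                     | inj₂ (_ , _ , _ , eq , _)  = ⊥-elim (𝐬≢∅ (sym eq))
      step : ∀ n → n ∈ ω → (∀ a b → ⟨ n , a ⟩ ∈ h → ⟨ n , b ⟩ ∈ h → a ≡ b) →
             ∀ a b → ⟨ 𝐬 n , a ⟩ ∈ h → ⟨ 𝐬 n , b ⟩ ∈ h → a ≡ b
      step n n∈ω ih a b p q with h-inversion p | h-inversion q
      ... | inj₁ (eq , _) | _             = ⊥-elim (𝐬≢∅ eq)
      ... | inj₂ _        | inj₁ (eq , _) = ⊥-elim (𝐬≢∅ eq)
      ... | inj₂ (m , a′ , m∈ω , eq , p′ , a′⇒a) | inj₂ (k , b′ , k∈ω , eq′ , q′ , b′⇒b)
        with 𝐬-injective m∈ω eq | 𝐬-injective k∈ω eq′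
      ... | refl | refl with ih a′ b′ p′ q′
      ... | refl = N-functional a′⇒a b′⇒b

    h-injective : ∀ n → n ∈ ω → ∀ m a → ⟨ n , a ⟩ ∈ h → ⟨ m , a ⟩ ∈ h → n ≡ m
    h-injective = ω-induction
      (∀ᵈ ∀ᵈ (⟨ 2F , 0F ⟩∈ᵈ 3F →ᵈ ⟨ 1F , 0F ⟩∈ᵈ 3F →ᵈ 2F ≡ᵈ 1F)) (h ∷ []) base step
      where
      base : ∀ m a → ⟨ ∅ , a ⟩ ∈ h → ⟨ m , a ⟩ ∈ h → ∅ ≡ m
      base m a p q with h-inversion p | h-inversion q
      ... | inj₁ _                    | inj₁ (eq , _)                    = sym eq
      ... | inj₂ (_ , _ , _ , eq , _) | _                                = ⊥-elim (𝐬≢∅ (sym eq))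
      ... | inj₁ (_ , refl)           | inj₂ (_ , _ , _ , _ , _ , b⇒c₀)  = ⊥-elim (¬N-c₀ b⇒c₀)
      step : ∀ n → n ∈ ω → (∀ m a → ⟨ n , a ⟩ ∈ h → ⟨ m , a ⟩ ∈ h → n ≡ m) →
             ∀ m a → ⟨ 𝐬 n , a ⟩ ∈ h → ⟨ m , a ⟩ ∈ h → 𝐬 n ≡ m
      step n n∈ω ih m a p q with h-inversion p | h-inversion q
      ... | inj₁ (eq , _)                   | _               = ⊥-elim (𝐬≢∅ eq)
      ... | inj₂ (_ , _ , _ , _ , _ , b⇒c₀) | inj₁ (_ , refl) = ⊥-elim (¬N-c₀ b⇒c₀)
      ... | inj₂ (k , a′ , k∈ω , eq , p′ , a′⇒a) | inj₂ (l , b′ , l∈ω , refl , q′ , b′⇒a)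
        with 𝐬-injective k∈ω eq | N-injective a′⇒a b′⇒a
      ... | refl | refl = cong 𝐬 (ih l a′ p′ q′)

    h-fun : h ∶ ⌜ ω ⌝ ⟶ ⌜ z ⌝
    h-fun = record
      { graph  = h⊆
      ; total  = λ n n∈ω → let (a , p) = h-total n n∈ω in
                   a , proj₁ (proj₂ (to (h-spec n a) p)) , p
      ; unique = λ n a b p → h-functional n (proj₁ (to (h-spec n a) p)) a b p }

    h-inj : IsInjective h
    h-inj n m a p = h-injective n (proj₁ (to (h-spec n a) p)) m a p

    -- An element a of z which is not a value would bound all values of h.
    h-onto : IsOnto h ⌜ z ⌝
    h-onto a a∈z = dne λ a∉ran → let
        a≢ : ∀ {n c} → ⟨ n , c ⟩ ∈ h → ¬ (c ≡ a)
        a≢ p eq = a∉ran (_ , subst (λ c → ⟨ _ , c ⟩ ∈ h) eq p)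
        below : ∀ {n c} → ⟨ n , c ⟩ ∈ h → ¬ (a ∈ c) → c ∈ a
        below {n} {c} p a∉c = [ id , [ ⊥-elim ∘ a≢ p , ⊥-elim ∘ a∉c ]′ ]′
          (<-cmp (z⊆ω (proj₁ (proj₂ (to (h-spec n c) p)))) (z⊆ω a∈z))
        bounded : ∀ n → n ∈ ω → ∀ c → ⟨ n , c ⟩ ∈ h → c ∈ a
        bounded = ω-induction (∀ᵈ (⟨ 1F , 0F ⟩∈ᵈ 2F →ᵈ 0F ∈ᵈ 3F)) (h ∷ a ∷ [])
          (λ c p → below p λ a∈c → c₀-min a
            (subst (a ∈_) (h-functional ∅ ∅∈ω c c₀ p (proj₁ h-closed)) a∈c) a∈z)
          λ n n∈ω ih c p → below p λ a∈c →
            let (b , q)   = h-total n n∈ω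
                (d , b⇒d) = next (proj₁ (proj₂ (to (h-spec n b) q)))
                d≡c = h-functional (𝐬 n) (𝐬∈ω n∈ω) d c
                        (proj₂ h-closed n b (𝐬 n) d q (σ⁺ n∈ω) b⇒d) p
            in proj₂ (proj₂ (proj₂ (to (N-spec b d) b⇒d))) a a∈z (ih b q)
                 (subst (a ∈_) (sym d≡c) a∈c)
      in no-injection (z⊆ω a∈z) h-inj λ n n∈ω →
           let (c , p) = h-total n n∈ω in c , bounded n n∈ω c p , p

  -- Dependent choice along a transitive relation

  -- Dependent choice relates only consecutive terms; transitivity extends this to all `m < n` by
  -- induction on `n`.
  dependent-sequence : DependentChoice → ∀ {X R} → (∃ λ x → x ∈ X) →
    ⌜ R ⌝ ⊆ ⌜ X ⌝ ⊗ ⌜ X ⌝ → (∀ x → x ∈ X → ∃ λ y → y ∈ X × ⟨ x , y ⟩ ∈ R) →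
    (∀ x y z → ⟨ x , y ⟩ ∈ R → ⟨ y , z ⟩ ∈ R → ⟨ x , z ⟩ ∈ R) →
    ∃ λ f → f ∶ ⌜ ω ⌝ ⟶ ⌜ X ⌝ ×
      (∀ m n p q → n ∈ ω → m ∈ n → ⟨ m , p ⟩ ∈ f → ⟨ n , q ⟩ ∈ f → ⟨ p , q ⟩ ∈ R)
  dependent-sequence dc {X} {R} X≢∅ R⊆ serial R-trans with dc X R X≢∅ R⊆ serial
  ... | f , f-fun , f-next = f , f-fun , λ m n p q n∈ω m∈n mp∈f nq∈f → ω-induction
      (1F ∈ᵈ 0F →ᵈ ∀ᵈ (⟨ 1F , 0F ⟩∈ᵈ 4F →ᵈ ⟨ 3F , 0F ⟩∈ᵈ 5F)) (m ∷ p ∷ f ∷ R ∷ [])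
      (λ m∈∅ → ⊥-elim (∉∅ m∈∅)) (step m p mp∈f) n n∈ω m∈n q nq∈f
    where
    open _∶_⟶_ f-fun
    f-suc : ∀ {n p q} → n ∈ ω → ⟨ n , p ⟩ ∈ f → ⟨ 𝐬 n , q ⟩ ∈ f → ⟨ p , q ⟩ ∈ R
    f-suc {n} {p} {q} n∈ω np∈f sq∈f
      with total n n∈ω | total (𝐬 n) (𝐬∈ω n∈ω)
         | f-next (n , n∈ω) (𝐬 n , 𝐬∈ω n∈ω) (𝐬-isSuccessor n)
    ... | p′ , _ , np′∈f | q′ , _ , sq′∈f | p′Rq′
      with unique n p p′ np∈f np′∈f | unique (𝐬 n) q q′ sq∈f sq′∈f
    ... | refl | refl = p′Rq′
    step : ∀ m p → ⟨ m , p ⟩ ∈ f → ∀ n → n ∈ ω →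
           (m ∈ n → ∀ q → ⟨ n , q ⟩ ∈ f → ⟨ p , q ⟩ ∈ R) →
           m ∈ 𝐬 n → ∀ q → ⟨ 𝐬 n , q ⟩ ∈ f → ⟨ p , q ⟩ ∈ R
    step m p mp∈f n n∈ω ih m∈𝐬n q sq∈f with to ∈-𝐬 m∈𝐬n
    ... | inj₂ refl = f-suc n∈ω mp∈f sq∈f
    ... | inj₁ m∈n with total n n∈ω
    ... | r , _ , nr∈f = R-trans p r q (ih m∈n r nr∈f) (f-suc n∈ω nr∈f sq∈f)

  -- Almost disjoint families

  MeetsUnboundedly : V → V → Set ℓ
  MeetsUnboundedly x y = ∀ n → n ∈ ω → ∃ λ m → n ∈ m × m ∈ x × m ∈ y

  almostDisjoint-≡ : ∀ {𝒜 x y} → AlmostDisjoint 𝒜 → x ∈ 𝒜 → y ∈ 𝒜 →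
                     MeetsUnboundedly x y → x ≡ y
  almostDisjoint-≡ {x = x} {y} (𝒜⊆ , 𝒜-ad) x∈𝒜 y∈𝒜 meets with 𝒜-ad x y x∈𝒜 y∈𝒜
  ... | inj₁ x≡y = x≡y
  ... | inj₂ fin with finite⇒bounded (λ (m∈x , _) → proj₁ (𝒜⊆ x∈𝒜) m∈x) fin
  ... | n , n∈ω , bdd with meets n n∈ω
  ... | m , n∈m , m∈x∩y = ⊥-elim (<-asym n∈ω (bdd m m∈x∩y) n∈m)

  ¬meets⇒finite : ∀ {x y} → ⌜ x ⌝ ⊆ ⌜ ω ⌝ → ¬ MeetsUnboundedly x y → Finite (⌜ x ⌝ ∩ ⌜ y ⌝)
  ¬meets⇒finite {x} {y} x⊆ω ¬meets with comprehension (0F ∈ᵈ 1F) (y ∷ []) x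
  ... | s , s-spec with ¬unbounded⇒bounded {s} (λ {m} m∈s → x⊆ω (proj₁ (to (s-spec m) m∈s)))
      (λ unb → ¬meets λ n n∈ω → let (m , n∈m , m∈s) = unb n n∈ω in m , n∈m , to (s-spec m) m∈s)
  ... | n , n∈ω , bdd = finite-resp-≐ (λ {m} → to (s-spec m)) (λ {m} → from (s-spec m))
                          (bounded⇒finite n∈ω bdd)

  -- Otherwise `x` could be added to `𝒜`, against maximality.
  mad-meets : ∀ {𝒜 x} → IsMad 𝒜 → ⌜ x ⌝ ⊆ ⌜ ω ⌝ → Unbounded x →
              ∃ λ y → y ∈ 𝒜 × MeetsUnboundedly y x
  mad-meets {𝒜} {x} (𝒜-ad@(𝒜⊆ , _) , maximal) x⊆ω x-unb = dne λ none →
    maximal (𝒜 ∪❴ x ❵) (ℬ⊆ , ℬ-ad none)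
      ( (λ y∈𝒜 → from ∈-∪❴❵ (inj₁ y∈𝒜))
      -- The extension is proper: were `x` in `𝒜` already, it would meet itself unboundedly.
      , λ ℬ⊆𝒜 → none (x , ℬ⊆𝒜 (from ∈-∪❴❵ (inj₂ refl)) ,
          λ n n∈ω → let (m , n∈m , m∈x) = x-unb n n∈ω in m , n∈m , m∈x , m∈x))
    where
    ℬ⊆ : ⌜ 𝒜 ∪❴ x ❵ ⌝ ⊆ [ ω ]^∞
    ℬ⊆ y∈ℬ with to ∈-∪❴❵ y∈ℬ
    ... | inj₁ y∈𝒜  = 𝒜⊆ y∈𝒜
    ... | inj₂ refl = x⊆ω , unbounded⇒countablyInfinite x⊆ω x-unb
    ℬ-ad : ¬ (∃ λ y → y ∈ 𝒜 × MeetsUnboundedly y x) →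
           ∀ y y′ → y ∈ (𝒜 ∪❴ x ❵) → y′ ∈ (𝒜 ∪❴ x ❵) → y ≡ y′ ⊎ Finite (⌜ y ⌝ ∩ ⌜ y′ ⌝)
    ℬ-ad none y y′ y∈ y′∈ with to ∈-∪❴❵ y∈ | to ∈-∪❴❵ y′∈
    ... | inj₁ y∈𝒜  | inj₁ y′∈𝒜 = proj₂ 𝒜-ad y y′ y∈𝒜 y′∈𝒜
    ... | inj₁ y∈𝒜  | inj₂ refl = inj₂
      (¬meets⇒finite (proj₁ (𝒜⊆ y∈𝒜)) λ meets → none (y , y∈𝒜 , meets))
    ... | inj₂ refl | inj₁ y′∈𝒜 = inj₂
      (finite-resp-≐ (λ (p , q) → q , p) (λ (p , q) → q , p)
        (¬meets⇒finite (proj₁ (𝒜⊆ y′∈𝒜)) λ meets → none (y′ , y′∈𝒜 , meets)))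
    ... | inj₂ refl | inj₂ refl = inj₁ refl

  -- The states are pairs `⟨ s , x ⟩` of a finite set `s` of used members and a member `x` outside
  -- `s`. A later state `⟨ t , y ⟩` must have `s` included in `t` and `x ∈ t`; this relation is
  -- transitive and keeps `y` away from all earlier members.
  distinct-sequence : DependentChoice → ∀ {𝒜} → ¬ Finite ⌜ 𝒜 ⌝ →
                      ∃ λ g → g ∶ ⌜ ω ⌝ ⟶ ⌜ 𝒜 ⌝ × IsInjective g
  distinct-sequence dc {𝒜} ¬fin with powerset 𝒜
  ... | 𝒫𝒜 , 𝒫𝒜-spec
    with relation (finiteᵈ 3F 1F ×ᵈ ¬ᵈ (0F ∈ᵈ 1F)) (ω ∷ []) 𝒫𝒜 𝒜
  ... | X , X⊆ , X-spec
    with relation (∃ᵈ ∃ᵈ ∃ᵈ ∃ᵈ (pairᵈ 5F 3F 2F ×ᵈ pairᵈ 4F 1F 0F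
           ×ᵈ ∀ᵈ (0F ∈ᵈ 4F →ᵈ 0F ∈ᵈ 2F) ×ᵈ 2F ∈ᵈ 1F)) [] X X
  ... | R , R⊆ , R-spec with dependent-sequence dc {X} {R} X≢∅ R⊆ serial R-trans
    where
    fresh : ∀ {s} → ⌜ s ⌝ ⊆ ⌜ 𝒜 ⌝ → Finite ⌜ s ⌝ → ∃ λ x → x ∈ 𝒜 × ¬ (x ∈ s)
    fresh s⊆𝒜 s-fin = dne λ none → ¬fin
      (finite-resp-≐ s⊆𝒜 (λ {x} x∈𝒜 → dne λ x∉s → none (x , x∈𝒜 , x∉s)) s-fin)
    extend : ∀ {s} → ⌜ s ⌝ ⊆ ⌜ 𝒜 ⌝ → Finite ⌜ s ⌝ → ∃ λ x → ⟨ s , x ⟩ ∈ X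
    extend {s} s⊆𝒜 s-fin = let (x , x∈𝒜 , x∉s) = fresh s⊆𝒜 s-fin in
      x , from (X-spec s x) (from (𝒫𝒜-spec s) (λ z → s⊆𝒜) , x∈𝒜 , s-fin , x∉s)
    X≢∅ : ∃ λ p → p ∈ X
    X≢∅ = _ , proj₂ (extend (λ z∈∅ → ⊥-elim (∉∅ z∈∅)) finite-∅)
    serial : ∀ p → p ∈ X → ∃ λ q → q ∈ X × ⟨ p , q ⟩ ∈ R
    serial p p∈X with X⊆ p∈X
    ... | s , x , _ , _ , refl with to (X-spec s x) p∈X
    ... | s∈𝒫𝒜 , x∈𝒜 , s-fin , _ with extend {s ∪❴ x ❵}
        (λ {z} z∈ → [ to (𝒫𝒜-spec s) s∈𝒫𝒜 z , (λ { refl → x∈𝒜 }) ]′ (to ∈-∪❴❵ z∈))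
        (finite-∪❴❵ s-fin)
    ... | y , q∈X = _ , q∈X , from (R-spec _ _) (p∈X , q∈X , _ , _ , _ , _ , refl , refl
        , (λ z z∈s → from ∈-∪❴❵ (inj₁ z∈s)) , from ∈-∪❴❵ (inj₂ refl))
    R-trans : ∀ p q r → ⟨ p , q ⟩ ∈ R → ⟨ q , r ⟩ ∈ R → ⟨ p , r ⟩ ∈ R
    R-trans p q r pq qr with to (R-spec p q) pq | to (R-spec q r) qr
    ... | p∈X , _ , s , x , t , y , refl , refl , s⊆t , x∈t
        | _ , r∈X , t′ , y′ , u , w , eq , refl , t⊆u , _ with pair-injective eq
    ... | refl , refl = from (R-spec p r) (p∈X , r∈X , s , x , u , w , refl , refl
                          , (λ z z∈s → t⊆u z (s⊆t z z∈s)) , t⊆u x x∈t)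
  ... | f , f-fun , f-increasing
    with relation (∃ᵈ ∃ᵈ (⟨ 3F , 1F ⟩∈ᵈ 5F ×ᵈ pairᵈ 1F 0F 2F)) (f ∷ []) ω 𝒜
  ... | g , g⊆ , g-spec = g , g-fun , g-inj
    where
    g-fun : g ∶ ⌜ ω ⌝ ⟶ ⌜ 𝒜 ⌝
    g-fun = record { graph = g⊆ ; total = g-total ; unique = g-unique }
      where
      g-total : ∀ n → n ∈ ω → ∃ λ x → x ∈ 𝒜 × ⟨ n , x ⟩ ∈ g
      g-total n n∈ω with _∶_⟶_.total f-fun n n∈ω
      ... | p , p∈X , np∈f with X⊆ p∈X
      ... | s , x , _ , x∈𝒜 , refl =
        x , x∈𝒜 , from (g-spec n x) (n∈ω , x∈𝒜 , _ , s , np∈f , refl)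
      g-unique : Functional g
      g-unique n x y nx ny with to (g-spec n x) nx | to (g-spec n y) ny
      ... | _ , _ , p , s , np∈f , eq | _ , _ , q , t , nq∈f , eq′
        with _∶_⟶_.unique f-fun n p q np∈f nq∈f
      ... | refl = proj₂ (pair-injective (trans (sym eq) eq′))
    g-< : ∀ {m n x y} → m ∈ n → ⟨ m , x ⟩ ∈ g → ⟨ n , y ⟩ ∈ g → ¬ (x ≡ y)
    g-< {m} {n} {x} m∈n mx ny refl with to (g-spec m x) mx | to (g-spec n x) ny
    ... | _ , _ , p , s , mp∈f , eq | n∈ω , _ , q , t , nq∈f , eq′
      with to (R-spec p q) (f-increasing m n p q n∈ω m∈n mp∈f nq∈f)
    ... | _ , q∈X , s′ , x′ , t′ , y′ , refl , refl , _ , x′∈t′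
      with pair-injective eq | pair-injective eq′
    ... | refl , refl | refl , refl = proj₂ (proj₂ (proj₂ (to (X-spec t x) q∈X))) x′∈t′
    g-inj : IsInjective g
    g-inj m n x mx nx with <-cmp (proj₁ (∶⟶-pair g-fun mx)) (proj₁ (∶⟶-pair g-fun nx))
    ... | inj₁ m∈n        = ⊥-elim (g-< m∈n mx nx refl)
    ... | inj₂ (inj₁ m≡n) = m≡n
    ... | inj₂ (inj₂ n∈m) = ⊥-elim (g-< n∈m nx mx refl)

  -- The selector T

  record IsSelected (g p k : V) : Set ℓ where
    constructor selected
    field
      {a b x} : V
      p≡ab    : p ≡ ⟨ a , b ⟩
      ax∈g    : ⟨ a , x ⟩ ∈ g
      k∈x     : k ∈ x
      b∈k     : b ∈ k
      k-least : ∀ j → j ∈ x → b ∈ j → ¬ (j ∈ k)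

  isSelectedᵈ : ∀ {n} (g p k : Fin n) →
    Definable (λ ρ → IsSelected (lookup ρ g) (lookup ρ p) (lookup ρ k))
  isSelectedᵈ g p k = mapᵈ
    (∃ᵈ ∃ᵈ ∃ᵈ (pairᵈ (suc (suc (suc p))) 2F 1F ×ᵈ ⟨ 2F , 0F ⟩∈ᵈ suc (suc (suc g))
      ×ᵈ suc (suc (suc k)) ∈ᵈ 0F ×ᵈ 1F ∈ᵈ suc (suc (suc k))
      ×ᵈ ∀ᵈ (0F ∈ᵈ 1F →ᵈ 2F ∈ᵈ 0F →ᵈ ¬ᵈ (0F ∈ᵈ suc (suc (suc (suc k)))))))
    (λ ρ → mk⇔ (λ (_ , _ , _ , eq , ax∈g , k∈x , b∈k , k-least) →
                  selected eq ax∈g k∈x b∈k k-least)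
               λ (selected eq ax∈g k∈x b∈k k-least) →
                  _ , _ , _ , eq , ax∈g , k∈x , b∈k , k-least)

  -- τ is the graph of T, for the sequence x with graph g.
  record Selector (g τ : V) : Set ℓ where
    field
      τ-total      : ∀ {a b} → a ∈ ω → b ∈ ω → ∃ λ k → ⟨ ⟨ a , b ⟩ , k ⟩ ∈ τ
      τ-functional : Functional τ
      τ-ω          : ∀ {p k} → ⟨ p , k ⟩ ∈ τ → k ∈ ω
      τ-above      : ∀ {a b k} → ⟨ ⟨ a , b ⟩ , k ⟩ ∈ τ → b ∈ k
      τ-member     : ∀ {a b k x} → ⟨ ⟨ a , b ⟩ , k ⟩ ∈ τ → ⟨ a , x ⟩ ∈ g → k ∈ x

  selector : ∀ {𝒜 g} → ⌜ 𝒜 ⌝ ⊆ [ ω ]^∞ → g ∶ ⌜ ω ⌝ ⟶ ⌜ 𝒜 ⌝ → ∃ (Selector g)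
  selector {𝒜} {g} 𝒜⊆ g-fun = τ , record
    { τ-total = τ-total
    ; τ-functional = λ p k l pk pl → selected-unique (τ⁻ pk) (τ⁻ pl) (τ-ω pk) (τ-ω pl)
    ; τ-ω = τ-ω
    ; τ-above = λ abk → selected-above (τ⁻ abk) refl
    ; τ-member = λ abk → selected-member (τ⁻ abk) refl }
    where
    open _∶_⟶_ g-fun
    ω² = proj₁ (product ω ω)
    τ-rel = relation (isSelectedᵈ 3F 1F 0F) (g ∷ []) ω² ω
    τ = proj₁ τ-rel
    τ⁻ : ∀ {p k} → ⟨ p , k ⟩ ∈ τ → IsSelected g p k
    τ⁻ pk = proj₂ (proj₂ (to (proj₂ (proj₂ τ-rel) _ _) pk))
    τ-ω : ∀ {p k} → ⟨ p , k ⟩ ∈ τ → k ∈ ω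
    τ-ω pk = proj₁ (proj₂ (to (proj₂ (proj₂ τ-rel) _ _) pk))
    τ⁺ : ∀ {a b k} → a ∈ ω → b ∈ ω → k ∈ ω → IsSelected g ⟨ a , b ⟩ k → ⟨ ⟨ a , b ⟩ , k ⟩ ∈ τ
    τ⁺ a∈ω b∈ω k∈ω sel = from (proj₂ (proj₂ τ-rel) _ _)
      (from (proj₂ (product ω ω) _) (_ , _ , a∈ω , b∈ω , refl) , k∈ω , sel)
    τ-total : ∀ {a b} → a ∈ ω → b ∈ ω → ∃ λ k → ⟨ ⟨ a , b ⟩ , k ⟩ ∈ τ
    τ-total {a} {b} a∈ω b∈ω =
      let (x , x∈𝒜 , ax∈g)    = total a a∈ω
          (x⊆ω , x-inf)       = 𝒜⊆ x∈𝒜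
          (m , b∈m , m∈x)     = countablyInfinite⇒unbounded x⊆ω x-inf b b∈ω
          (k , k∈ω , (k∈x , b∈k) , k-min) =
            least (0F ∈ᵈ 1F ×ᵈ 2F ∈ᵈ 0F) (x ∷ b ∷ []) m (x⊆ω m∈x) (m∈x , b∈m)
      in k , τ⁺ a∈ω b∈ω k∈ω
               (selected refl ax∈g k∈x b∈k λ j j∈x b∈j j∈k → k-min j j∈k (j∈x , b∈j))
    selected-unique : ∀ {p k l} → IsSelected g p k → IsSelected g p l → k ∈ ω → l ∈ ω → k ≡ l
    selected-unique {p} {k} {l} (selected refl ax∈g k∈x b∈k k-least)
                        (selected eq ax′∈g l∈x b∈l l-least) k∈ω l∈ω
      with pair-injective eq
    ... | refl , refl with unique _ _ _ ax∈g ax′∈g | <-cmp k∈ω l∈ω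
    ... | refl | inj₁ k∈l        = ⊥-elim (l-least k k∈x b∈k k∈l)
    ... | refl | inj₂ (inj₁ k≡l) = k≡l
    ... | refl | inj₂ (inj₂ l∈k) = ⊥-elim (k-least l l∈x b∈l l∈k)
    selected-above : ∀ {a b k p} → IsSelected g p k → p ≡ ⟨ a , b ⟩ → b ∈ k
    selected-above (selected refl _ _ b∈k _) eq with pair-injective eq
    ... | refl , refl = b∈k
    selected-member : ∀ {a b k p x} → IsSelected g p k → p ≡ ⟨ a , b ⟩ → ⟨ a , x ⟩ ∈ g → k ∈ x
    selected-member (selected refl ax′∈g k∈x′ _ _) eq ax∈g with pair-injective eq
    ... | refl , refl with unique _ _ _ ax∈g ax′∈g
    ... | refl = k∈x′

  -- Separated sets of pairs

  -- The pairs are intervals [a,b], of which any two distinct ones are disjoint. This replaces an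
  -- enumeration of `z` with a parity condition, and it passes to subsets of `P`.
  Separated : V → Set ℓ
  Separated P = (∀ a b → ⟨ a , b ⟩ ∈ P → a ∈ b) ×
    (∀ a b c d → ⟨ a , b ⟩ ∈ P → ⟨ c , d ⟩ ∈ P → (a ≡ c × b ≡ d) ⊎ b ∈ c ⊎ d ∈ a)

  -- By the two inclusions P pairs the first element of z with the second, the third
  -- with the fourth, and so on.
  Matches : V → V → Set ℓ
  Matches P z = Separated P × (∀ a b → ⟨ a , b ⟩ ∈ P → a ∈ z × b ∈ z) ×
    (∀ c → c ∈ z → ∃ λ d → ⟨ c , d ⟩ ∈ P ⊎ ⟨ d , c ⟩ ∈ P)

  opaque
    matchesᵈ : ∀ {n} (P z : Fin n) → Definable (λ ρ → Matches (lookup ρ P) (lookup ρ z))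
    matchesᵈ P z =
      (∀ᵈ ∀ᵈ (⟨ 1F , 0F ⟩∈ᵈ suc (suc P) →ᵈ 1F ∈ᵈ 0F) ×ᵈ
       ∀ᵈ ∀ᵈ ∀ᵈ ∀ᵈ (⟨ 3F , 2F ⟩∈ᵈ suc (suc (suc (suc P))) →ᵈ
         ⟨ 1F , 0F ⟩∈ᵈ suc (suc (suc (suc P))) →ᵈ
         (3F ≡ᵈ 1F ×ᵈ 2F ≡ᵈ 0F) ⊎ᵈ 2F ∈ᵈ 1F ⊎ᵈ 0F ∈ᵈ 3F)) ×ᵈ
      ∀ᵈ ∀ᵈ (⟨ 1F , 0F ⟩∈ᵈ suc (suc P) →ᵈ 1F ∈ᵈ suc (suc z) ×ᵈ 0F ∈ᵈ suc (suc z)) ×ᵈ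
      ∀ᵈ (0F ∈ᵈ suc z →ᵈ ∃ᵈ (⟨ 1F , 0F ⟩∈ᵈ suc (suc P) ⊎ᵈ ⟨ 0F , 1F ⟩∈ᵈ suc (suc P)))

  -- With `z` the set of endpoints, every separated set of pairs from `B` becomes the pairing of a
  -- subset of `B`, where homogeneity can be used.
  separated-matches : ∀ {P B} → Separated P → (∀ a b → ⟨ a , b ⟩ ∈ P → a ∈ B × b ∈ B) →
                      ∃ λ z → ⌜ z ⌝ ⊆ ⌜ B ⌝ × Matches P z
  separated-matches {P} {B} P-sep P⊆B
    with comprehension (∃ᵈ (⟨ 1F , 0F ⟩∈ᵈ 2F ⊎ᵈ ⟨ 0F , 1F ⟩∈ᵈ 2F)) (P ∷ []) B
  ... | z , z-spec = z , (λ {c} c∈z → proj₁ (to (z-spec c) c∈z)) , P-sep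
    , (λ a b p → from (z-spec a) (proj₁ (P⊆B a b p) , b , inj₁ p)
               , from (z-spec b) (proj₂ (P⊆B a b p) , a , inj₂ p))
    , λ c c∈z → proj₂ (to (z-spec c) c∈z)

  module _ {P z} (z⊆ω : ⌜ z ⌝ ⊆ ⌜ ω ⌝) (P-matches : Matches P z) where

    private
      P-<   = proj₁ (proj₁ P-matches)
      P-sep = proj₂ (proj₁ P-matches)
      P⊆z   = proj₁ (proj₂ P-matches)
      z⊆P   = proj₂ (proj₂ P-matches)

    matches-ω : ∀ {a b} → ⟨ a , b ⟩ ∈ P → a ∈ ω × b ∈ ω
    matches-ω p = z⊆ω (proj₁ (P⊆z _ _ p)) , z⊆ω (proj₂ (P⊆z _ _ p))

    matches-functional : ∀ {a b c} → ⟨ a , b ⟩ ∈ P → ⟨ a , c ⟩ ∈ P → b ≡ c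
    matches-functional {a} {b} {c} p q with P-sep a b a c p q
    ... | inj₁ (_ , b≡c)  = b≡c
    ... | inj₂ (inj₁ b∈a) = ⊥-elim (<-asym (proj₂ (matches-ω p)) (P-< a b p) b∈a)
    ... | inj₂ (inj₂ c∈a) = ⊥-elim (<-asym (proj₂ (matches-ω q)) (P-< a c q) c∈a)

    matches-no-chain : ∀ {a b c} → ⟨ a , b ⟩ ∈ P → ¬ (⟨ b , c ⟩ ∈ P)
    matches-no-chain {a} {b} {c} p q with P-sep a b b c p q
    ... | inj₁ (refl , _) = x∉x (P-< a b p)
    ... | inj₂ (inj₁ b∈b) = x∉x b∈b
    ... | inj₂ (inj₂ c∈a) = <-asym (proj₂ (matches-ω q))
      (<-trans (proj₂ (matches-ω q)) (P-< a b p) (P-< b c q)) c∈a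

    -- Such a `c` would be an endpoint of another interval of `P`, overlapping [a,b].
    matches-consecutive : ∀ {a b c} → ⟨ a , b ⟩ ∈ P → c ∈ z → a ∈ c → ¬ (c ∈ b)
    matches-consecutive {a} {b} {c} p c∈z a∈c c∈b with z⊆P c c∈z
    ... | d , inj₁ q with P-sep a b c d p q
    ... | inj₁ (refl , _) = x∉x a∈c
    ... | inj₂ (inj₁ b∈c) = <-asym (z⊆ω c∈z) b∈c c∈b
    ... | inj₂ (inj₂ d∈a) = <-asym (z⊆ω c∈z) (<-trans (z⊆ω c∈z) d∈a a∈c) (P-< c d q)
    matches-consecutive {a} {b} {c} p c∈z a∈c c∈b | d , inj₂ q with P-sep a b d c p q
    ... | inj₁ (_ , refl) = x∉x c∈b
    ... | inj₂ (inj₁ b∈d) = <-asym (z⊆ω c∈z) (<-trans (z⊆ω c∈z) b∈d (P-< d c q)) c∈b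
    ... | inj₂ (inj₂ c∈a) = <-asym (z⊆ω c∈z) a∈c c∈a

    -- An element `c` of `z` above `n` may be a right endpoint. Then a later element `e` belongs to
    -- a different interval, which lies entirely above `c`.
    matches-tail : Unbounded z → ∀ n → n ∈ ω → ∃₂ λ a b → ⟨ a , b ⟩ ∈ P × n ∈ a
    matches-tail z-unb n n∈ω with z-unb n n∈ω
    ... | c , n∈c , c∈z with z⊆P c c∈z
    ... | d , inj₁ p = c , d , p , n∈c
    ... | d , inj₂ p with z-unb c (z⊆ω c∈z)
    ... | e , c∈e , e∈z with z⊆P e e∈z
    ... | j , inj₁ q = e , j , q , <-trans (z⊆ω e∈z) n∈c c∈e
    ... | j , inj₂ q with P-sep d c j e p q
    ... | inj₁ (_ , refl) = ⊥-elim (x∉x c∈e)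
    ... | inj₂ (inj₁ c∈j) = j , e , q , <-trans (proj₁ (matches-ω q)) n∈c c∈j
    ... | inj₂ (inj₂ e∈d) = ⊥-elim (<-asym (z⊆ω e∈z) c∈e
      (<-trans (z⊆ω c∈z) e∈d (P-< d c p)))

  -- The pairing is determined by `z`: strong induction on the left endpoint. If `a` is a left
  -- endpoint in both, its partner is in both cases the next element of `z`.
  matches-unique : ∀ {P Q z} → ⌜ z ⌝ ⊆ ⌜ ω ⌝ → Matches P z → Matches Q z →
                   ∀ a b → ⟨ a , b ⟩ ∈ P → ⟨ a , b ⟩ ∈ Q
  matches-unique {P} {Q} {z} z⊆ω
    P-matches@((P-< , P-sep) , P⊆z , z⊆P) Q-matches@((Q-< , Q-sep) , Q⊆z , z⊆Q) a b p =
    strong-induction (∀ᵈ (⟨ 1F , 0F ⟩∈ᵈ 2F →ᵈ ⟨ 1F , 0F ⟩∈ᵈ 3F)) (P ∷ Q ∷ []) step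
      a (proj₁ (matches-ω z⊆ω P-matches p)) b p
    where
    step : ∀ a → a ∈ ω → (∀ m → m ∈ a → ∀ b → ⟨ m , b ⟩ ∈ P → ⟨ m , b ⟩ ∈ Q) →
           ∀ b → ⟨ a , b ⟩ ∈ P → ⟨ a , b ⟩ ∈ Q
    step a a∈ω ih b p with z⊆Q a (proj₁ (P⊆z a b p))
    ... | c , inj₁ q with <-cmp (z⊆ω (proj₂ (P⊆z a b p))) (z⊆ω (proj₂ (Q⊆z a c q)))
    ... | inj₁ b∈c =
      ⊥-elim (matches-consecutive z⊆ω Q-matches q (proj₂ (P⊆z a b p)) (P-< a b p) b∈c)
    ... | inj₂ (inj₁ refl) = q
    ... | inj₂ (inj₂ c∈b) =
      ⊥-elim (matches-consecutive z⊆ω P-matches p (proj₂ (Q⊆z a c q)) (Q-< a c q) c∈b)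
    -- Here `a` is a left endpoint in `P` but a right endpoint in `Q`. The pair of `P` containing
    -- `d` starts below `a`, so it lies in `Q` by induction; this creates two pairs sharing an
    -- endpoint, in `P` or in `Q`.
    step a a∈ω ih b p | d , inj₂ q with z⊆P d (proj₁ (Q⊆z d a q))
    ... | e , inj₁ p′ with matches-functional z⊆ω Q-matches q (ih d (Q-< d a q) e p′)
    ... | refl = ⊥-elim (matches-no-chain z⊆ω P-matches p′ p)
    step a a∈ω ih b p | d , inj₂ q | e , inj₂ p′ = ⊥-elim (matches-no-chain z⊆ω Q-matches
      (ih e (<-trans a∈ω (P-< e d p′) (Q-< d a q)) d p′) q)

  -- The pairs are picked one above another and may skip elements of `B`, since any separated set of
  -- pairs is the pairing of its own endpoints.
  separated-sequence : DependentChoice → ∀ {B} → ⌜ B ⌝ ⊆ ⌜ ω ⌝ → Unbounded B →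
    ∃ λ P → (∀ p → p ∈ P → ∃₂ λ a b → p ≡ ⟨ a , b ⟩ × a ∈ B × b ∈ B) × Separated P ×
      (∀ n → n ∈ ω → ∃₂ λ a b → ⟨ a , b ⟩ ∈ P × n ∈ b)
  separated-sequence dc {B} B⊆ω B-unb with relation (1F ∈ᵈ 0F) [] B B
  ... | X , X⊆ , X-spec
    with relation (∃ᵈ ∃ᵈ ∃ᵈ ∃ᵈ (pairᵈ 5F 3F 2F ×ᵈ pairᵈ 4F 1F 0F ×ᵈ 2F ∈ᵈ 1F)) [] X X
  ... | R , R⊆ , R-spec with dependent-sequence dc {X} {R} X≢∅ R⊆ serial R-trans
    where
    pair-above : ∀ n → n ∈ ω → ∃₂ λ a b → ⟨ a , b ⟩ ∈ X × n ∈ a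
    pair-above n n∈ω with B-unb n n∈ω
    ... | a , n∈a , a∈B with B-unb a (B⊆ω a∈B)
    ... | b , a∈b , b∈B = a , b , from (X-spec a b) (a∈B , b∈B , a∈b) , n∈a
    X≢∅ : ∃ λ p → p ∈ X
    X≢∅ = let (a , b , p∈X , _) = pair-above ∅ ∅∈ω in ⟨ a , b ⟩ , p∈X
    serial : ∀ p → p ∈ X → ∃ λ q → q ∈ X × ⟨ p , q ⟩ ∈ R
    serial p p∈X with X⊆ p∈X
    ... | a , b , _ , b∈B , refl with pair-above b (B⊆ω b∈B)
    ... | c , d , q∈X , b∈c = ⟨ c , d ⟩ , q∈X
        , from (R-spec _ _) (p∈X , q∈X , a , b , c , d , refl , refl , b∈c)
    R-trans : ∀ p q r → ⟨ p , q ⟩ ∈ R → ⟨ q , r ⟩ ∈ R → ⟨ p , r ⟩ ∈ R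
    R-trans p q r pq qr with to (R-spec p q) pq | to (R-spec q r) qr
    ... | p∈X , q∈X , a , b , c , d , refl , refl , b∈c
        | _ , r∈X , c′ , d′ , i , j , eq , refl , d∈i with pair-injective eq
    ... | refl , refl with to (X-spec c d) q∈X | to (X-spec i j) r∈X
    ... | _ , d∈B , c∈d | i∈B , _ = from (R-spec p r) (p∈X , r∈X , a , b , i , j , refl , refl
        , <-trans (B⊆ω i∈B) (<-trans (B⊆ω d∈B) b∈c c∈d) d∈i)
  ... | f , f-fun , f-increasing with comprehension (∃ᵈ ⟨ 0F , 1F ⟩∈ᵈ 2F) (f ∷ []) X
  ... | P , P-spec = P , P-pairs , (P-< , P-sep) , P-unb
    where
    open _∶_⟶_ f-fun
    P-pairs : ∀ p → p ∈ P → ∃₂ λ a b → p ≡ ⟨ a , b ⟩ × a ∈ B × b ∈ B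
    P-pairs p p∈P with X⊆ (proj₁ (to (P-spec p) p∈P))
    ... | a , b , a∈B , b∈B , eq = a , b , eq , a∈B , b∈B
    P-< : ∀ a b → ⟨ a , b ⟩ ∈ P → a ∈ b
    P-< a b p∈P = proj₂ (proj₂ (to (X-spec a b) (proj₁ (to (P-spec _) p∈P))))
    R-< : ∀ {a b c d} → ⟨ ⟨ a , b ⟩ , ⟨ c , d ⟩ ⟩ ∈ R → b ∈ c
    R-< {a} {b} {c} {d} pq with to (R-spec _ _) pq
    ... | _ , _ , _ , _ , _ , _ , eq , eq′ , b∈c with pair-injective eq | pair-injective eq′
    ... | refl , refl | refl , refl = b∈c
    P-sep : ∀ a b c d → ⟨ a , b ⟩ ∈ P → ⟨ c , d ⟩ ∈ P → (a ≡ c × b ≡ d) ⊎ b ∈ c ⊎ d ∈ a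
    P-sep a b c d p q with to (P-spec _) p | to (P-spec _) q
    ... | _ , m , mp∈f | _ , n , nq∈f with ∶⟶-pair f-fun mp∈f | ∶⟶-pair f-fun nq∈f
    ... | m∈ω , _ | n∈ω , _ with <-cmp m∈ω n∈ω
    ... | inj₁ m∈n         = inj₂ (inj₁ (R-< (f-increasing m n _ _ n∈ω m∈n mp∈f nq∈f)))
    ... | inj₂ (inj₁ refl) = inj₁ (pair-injective (unique m _ _ mp∈f nq∈f))
    ... | inj₂ (inj₂ n∈m)  = inj₂ (inj₂ (R-< (f-increasing n m _ _ m∈ω n∈m nq∈f mp∈f)))
    above : ∀ n → n ∈ ω → ∀ p → ⟨ n , p ⟩ ∈ f → ∃₂ λ a b → p ≡ ⟨ a , b ⟩ × n ∈ b
    above = ω-induction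
      (∀ᵈ (⟨ 1F , 0F ⟩∈ᵈ 2F →ᵈ ∃ᵈ ∃ᵈ (pairᵈ 2F 1F 0F ×ᵈ 3F ∈ᵈ 0F))) (f ∷ []) base step
      where
      base : ∀ p → ⟨ ∅ , p ⟩ ∈ f → ∃₂ λ a b → p ≡ ⟨ a , b ⟩ × ∅ ∈ b
      base p np∈f with ∶⟶-pair f-fun np∈f
      ... | _ , p∈X with X⊆ p∈X
      ... | a , b , _ , b∈B , refl =
        a , b , refl , ∅∈-nonempty (B⊆ω b∈B) (proj₂ (proj₂ (to (X-spec a b) p∈X)))
      step : ∀ n → n ∈ ω → (∀ p → ⟨ n , p ⟩ ∈ f → ∃₂ λ a b → p ≡ ⟨ a , b ⟩ × n ∈ b) →
             ∀ q → ⟨ 𝐬 n , q ⟩ ∈ f → ∃₂ λ c d → q ≡ ⟨ c , d ⟩ × 𝐬 n ∈ d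
      step n n∈ω ih q sq∈f with total n n∈ω
      ... | p , p∈X , np∈f with ih p np∈f | ∶⟶-pair f-fun sq∈f
      ... | a , b , refl , n∈b | _ , q∈X with X⊆ q∈X
      ... | c , d , _ , d∈B , refl = c , d , refl ,
        [ (λ sn∈b → <-trans d∈ω sn∈b b∈d) , (λ sn≡b → subst (_∈ d) (sym sn≡b) b∈d) ]′ (𝐬-≤ b∈ω n∈b)
        where
        d∈ω = B⊆ω d∈B
        b∈ω = B⊆ω (proj₁ (proj₂ (to (X-spec a b) p∈X)))
        b∈d = <-trans d∈ω
          (R-< (f-increasing n (𝐬 n) _ _ (𝐬∈ω n∈ω) n∈𝐬n np∈f sq∈f))
          (proj₂ (proj₂ (to (X-spec c d) q∈X)))
    P-unb : ∀ n → n ∈ ω → ∃₂ λ a b → ⟨ a , b ⟩ ∈ P × n ∈ b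
    P-unb n n∈ω with total n n∈ω
    ... | p , p∈X , np∈f with above n n∈ω p np∈f
    ... | a , b , refl , n∈b = a , b , from (P-spec _) (p∈X , n , np∈f) , n∈b

  -- The coloring

  Captures : V → V → V → Set ℓ
  Captures τ P y = ∀ p k → p ∈ P → ⟨ p , k ⟩ ∈ τ → k ∈ y

  -- By `matches-unique`, the existentially quantified `P` has the same ordered pairs as any other
  -- pairing of `z`.
  record Captured (𝒜 τ z : V) : Set ℓ where
    constructor captured
    field
      {y P}    : V
      y∈𝒜      : y ∈ 𝒜
      matches  : Matches P z
      captures : Captures τ P y

  opaque
    capturedᵈ : ∀ {n} (𝒜 τ z : Fin n) →
      Definable (λ ρ → Captured (lookup ρ 𝒜) (lookup ρ τ) (lookup ρ z))
    capturedᵈ 𝒜 τ z = mapᵈ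
      (∃ᵈ ∃ᵈ (1F ∈ᵈ suc (suc 𝒜) ×ᵈ matchesᵈ 0F (suc (suc z)) ×ᵈ
        ∀ᵈ ∀ᵈ (1F ∈ᵈ 2F →ᵈ ⟨ 1F , 0F ⟩∈ᵈ suc (suc (suc (suc τ))) →ᵈ 0F ∈ᵈ 3F)))
      (λ ρ → mk⇔ (λ (_ , _ , y∈𝒜 , P-matches , P-captures) → captured y∈𝒜 P-matches P-captures)
                 λ (captured y∈𝒜 P-matches P-captures) → _ , _ , y∈𝒜 , P-matches , P-captures)

    unboundedᵈ : ∀ {n} (w z : Fin n) → Definable (λ ρ →
      ∀ n → n ∈ lookup ρ w → ∃ λ m → n ∈ m × m ∈ lookup ρ z)
    unboundedᵈ w z = ∀ᵈ (0F ∈ᵈ suc w →ᵈ ∃ᵈ (1F ∈ᵈ 0F ×ᵈ 0F ∈ᵈ suc (suc z)))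

  captured-set : ∀ 𝒜 τ → ∃ λ S → ∀ z →
    z ∈ S ⇔ (⌜ z ⌝ ⊆ ⌜ ω ⌝ × Unbounded z × Captured 𝒜 τ z)
  captured-set 𝒜 τ with powerset ω
  ... | 𝒫ω , 𝒫ω-spec
    with comprehension (unboundedᵈ 1F 0F ×ᵈ capturedᵈ 2F 3F 0F) (ω ∷ 𝒜 ∷ τ ∷ []) 𝒫ω
  ... | S , S-spec = S , λ z → mk⇔
    (λ z∈S → let (z∈𝒫ω , unb , cap) = to (S-spec z) z∈S in
      (λ {m} → to (𝒫ω-spec z) z∈𝒫ω m) , unb , cap)
    λ (z⊆ω , unb , cap) → from (S-spec z) (from (𝒫ω-spec z) (λ m → z⊆ω) , unb , cap)

  module _ {𝒜 g τ} (𝒜-mad : IsMad 𝒜) (g-fun : g ∶ ⌜ ω ⌝ ⟶ ⌜ 𝒜 ⌝) (g-inj : IsInjective g)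
           (τ-sel : Selector g τ) where

    open Selector τ-sel

    -- Captured sets inside every unbounded set

    module _ {B P} (B⊆ω : ⌜ B ⌝ ⊆ ⌜ ω ⌝)
             (P-pairs : ∀ p → p ∈ P → ∃₂ λ a b → p ≡ ⟨ a , b ⟩ × a ∈ B × b ∈ B)
             (P-separated : Separated P)
             (P-unb : ∀ n → n ∈ ω → ∃₂ λ a b → ⟨ a , b ⟩ ∈ P × n ∈ b) where

      private
        P-<   = proj₁ P-separated
        P-sep = proj₂ P-separated

        P⊆B : ∀ a b → ⟨ a , b ⟩ ∈ P → a ∈ B × b ∈ B
        P⊆B a b p with P-pairs _ p
        ... | _ , _ , eq , a∈B , b∈B with pair-injective eq
        ... | refl , refl = a∈B , b∈B

        P-injective : ∀ {a b c} → ⟨ a , c ⟩ ∈ P → ⟨ b , c ⟩ ∈ P → a ≡ b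
        P-injective {a} {b} {c} p q with P-sep a c b c p q
        ... | inj₁ (a≡b , _)  = a≡b
        ... | inj₂ (inj₁ c∈b) = ⊥-elim (<-asym (B⊆ω (proj₂ (P⊆B b c q))) (P-< b c q) c∈b)
        ... | inj₂ (inj₂ c∈a) = ⊥-elim (<-asym (B⊆ω (proj₂ (P⊆B a c p))) (P-< a c p) c∈a)

        -- The selector is reindexed by the second entry of the pairs in `P`, which determines the
        -- pair; its arguments are then natural numbers and `bounded-image` applies.
        SecondValue : V → Set ℓ
        SecondValue r = ∀ b k → ⟨ b , k ⟩ ∈ r ⇔ (b ∈ ω × k ∈ ω ×
          ∃₂ λ a p → p ≡ ⟨ a , b ⟩ × p ∈ P × ⟨ p , k ⟩ ∈ τ)

        secondValue-functional : ∀ {r} → SecondValue r → Functional r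
        secondValue-functional r-spec b k l bk bl with to (r-spec b k) bk | to (r-spec b l) bl
        ... | _ , _ , a , _ , refl , p , pk | _ , _ , a′ , _ , refl , p′ , pl with P-injective p p′
        ... | refl = τ-functional _ k l pk pl

        opaque
          -- Only boundedly many values of τ on P come from pairs ⟨a,b⟩ with b < n.
          values-bound : ∀ {n} → n ∈ ω → ∃ λ m → m ∈ ω ×
            (∀ a b k → ⟨ a , b ⟩ ∈ P → ⟨ ⟨ a , b ⟩ , k ⟩ ∈ τ → b ∈ n → k ∈ m)
          values-bound n∈ω =
            let (r , _ , r-spec) = relation
                  (∃ᵈ ∃ᵈ (pairᵈ 0F 1F 3F ×ᵈ 0F ∈ᵈ 5F ×ᵈ ⟨ 0F , 2F ⟩∈ᵈ 6F)) (P ∷ τ ∷ []) ω ω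
                (m , m∈ω , m-bound) = bounded-image {r} (secondValue-functional r-spec) n∈ω
            in m , m∈ω , λ a b k p pk b∈n → m-bound b b∈n k (τ-ω pk)
                 (from (r-spec b k) (B⊆ω (proj₂ (P⊆B a b p)) , τ-ω pk , a , _ , refl , p , pk))

        Values : V → Set ℓ
        Values ẑ = ∀ k → k ∈ ẑ ⇔ (k ∈ ω × ∃ λ p → p ∈ P × ⟨ p , k ⟩ ∈ τ)

        Thinned : V → V → Set ℓ
        Thinned y P′ = ∀ p → p ∈ P′ ⇔ (p ∈ P × ∃ λ k → ⟨ p , k ⟩ ∈ τ × k ∈ y)

        values-unbounded : ∀ {ẑ} → Values ẑ → Unbounded ẑ
        values-unbounded ẑ-spec n n∈ω =
          let (a , b , p , n∈b) = P-unb n n∈ω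
              (a∈B , b∈B)       = P⊆B a b p
              (k , pk)          = τ-total (B⊆ω a∈B) (B⊆ω b∈B)
          in k , <-trans (τ-ω pk) n∈b (τ-above pk) , from (ẑ-spec k) (τ-ω pk , ⟨ a , b ⟩ , p , pk)

        -- A value in `y` beyond all those coming from pairs with a small second entry must come
        -- from a pair whose second entry is large.
        thinned-unbounded : ∀ {ẑ y P′ z} → Values ẑ → MeetsUnboundedly y ẑ →
                            Thinned y P′ → Matches P′ z → Unbounded z
        thinned-unbounded ẑ-spec meets P′-spec (_ , P′⊆z , _) n n∈ω
          -- The bound is taken at `𝐬 n` because the pairs to be excluded are those with `b ≤ n`.
          with values-bound (𝐬∈ω n∈ω)
        ... | m , m∈ω , m-bound with meets m m∈ω
        ... | k , m∈k , k∈y , k∈ẑ with to (ẑ-spec k) k∈ẑ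
        ... | k∈ω , p , p∈P , pk with P-pairs p p∈P
        ... | a , b , refl , a∈B , b∈B with <-cmp n∈ω (B⊆ω b∈B)
        ... | inj₁ n∈b = b , n∈b , proj₂ (P′⊆z a b (from (P′-spec _) (p∈P , k , pk , k∈y)))
        ... | inj₂ b≤n = ⊥-elim (<-asym k∈ω m∈k
          (m-bound a b k p∈P pk (from ∈-𝐬 ([ inj₂ ∘ sym , inj₁ ]′ b≤n))))

        thinned-captures : ∀ {y P′} → Thinned y P′ → Captures τ P′ y
        thinned-captures P′-spec p k p∈P′ pk =
          let (_ , l , pl , l∈y) = to (P′-spec p) p∈P′ in
          subst (_∈ _) (τ-functional p l k pl pk) l∈y

        thinned-matches : ∀ {y P′} → Thinned y P′ → ∃ λ z → ⌜ z ⌝ ⊆ ⌜ B ⌝ × Matches P′ z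
        thinned-matches {P′ = P′} P′-spec = separated-matches
          ((λ a b p → P-< a b (P′⊆P p)) , λ a b c d p q → P-sep a b c d (P′⊆P p) (P′⊆P q))
          λ a b p → P⊆B a b (P′⊆P p)
          where
          P′⊆P : ∀ {p} → p ∈ P′ → p ∈ P
          P′⊆P p∈P′ = proj₁ (to (P′-spec _) p∈P′)

      thinning-captured : ∃ λ z → ⌜ z ⌝ ⊆ ⌜ B ⌝ × Unbounded z × Captured 𝒜 τ z
      thinning-captured =
        let (ẑ , ẑ-spec)         = comprehension (∃ᵈ (0F ∈ᵈ 2F ×ᵈ ⟨ 0F , 1F ⟩∈ᵈ 3F)) (P ∷ τ ∷ []) ω
            (y , y∈𝒜 , meets)    = mad-meets 𝒜-mad (λ {k} k∈ẑ → proj₁ (to (ẑ-spec k) k∈ẑ))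
                                     (values-unbounded ẑ-spec)
            (P′ , P′-spec)       = comprehension (∃ᵈ (⟨ 1F , 0F ⟩∈ᵈ 2F ×ᵈ 0F ∈ᵈ 3F)) (τ ∷ y ∷ []) P
            (z , z⊆B , z-matches) = thinned-matches P′-spec
        in z , z⊆B , thinned-unbounded ẑ-spec meets P′-spec z-matches
             , captured y∈𝒜 z-matches (thinned-captures P′-spec)

    captured-exists : DependentChoice → ∀ {B} → ⌜ B ⌝ ⊆ ⌜ ω ⌝ → Unbounded B →
                      ∃ λ z → ⌜ z ⌝ ⊆ ⌜ B ⌝ × Unbounded z × Captured 𝒜 τ z
    captured-exists dc {B} B⊆ω B-unb =
      let (P , P-pairs , P-separated , P-unb) = separated-sequence dc B⊆ω B-unb in
      thinning-captured B⊆ω P-pairs P-separated P-unb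

    -- Grafting a pair whose value escapes the capturing member

    other-member : ∀ {B} y → ⌜ B ⌝ ⊆ ⌜ ω ⌝ → Unbounded B →
                   ∃₂ λ a x → a ∈ B × ⟨ a , x ⟩ ∈ g × x ∈ 𝒜 × ¬ (x ≡ y)
    other-member {B} y B⊆ω B-unb with B-unb ∅ ∅∈ω
    ... | a , _ , a∈B with B-unb a (B⊆ω a∈B)
    ... | b , a∈b , b∈B
      with _∶_⟶_.total g-fun a (B⊆ω a∈B) | _∶_⟶_.total g-fun b (B⊆ω b∈B)
    ... | x , x∈𝒜 , ax∈g | w , w∈𝒜 , bw∈g with em {P = x ≡ y}
    ... | no x≢y   = a , x , a∈B , ax∈g , x∈𝒜 , x≢y
    ... | yes refl = b , w , b∈B , bw∈g , w∈𝒜 , λ { refl →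
      x∉x (subst (_∈ b) (g-inj a b x ax∈g bw∈g) a∈b) }

    -- For `x ≢ y` the intersection of `x` and `y` has no element above some `n`. With `b` above
    -- both `a` and `n`, the selected value lies in `x` and exceeds `n`, so it is not in `y`.
    evading-pair : ∀ {B y} → y ∈ 𝒜 → ⌜ B ⌝ ⊆ ⌜ ω ⌝ → Unbounded B →
      ∃₂ λ a b → a ∈ B × b ∈ B × a ∈ b × (∃ λ k → ⟨ ⟨ a , b ⟩ , k ⟩ ∈ τ × ¬ (k ∈ y))
    evading-pair {B} {y} y∈𝒜 B⊆ω B-unb with other-member y B⊆ω B-unb
    ... | a , x , a∈B , ax∈g , x∈𝒜 , x≢y
      with dne {∃ λ n → n ∈ ω × ¬ (∃ λ m → n ∈ m × m ∈ x × m ∈ y)}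
          (λ ¬bdd → x≢y (almostDisjoint-≡ (proj₁ 𝒜-mad) x∈𝒜 y∈𝒜
            λ n n∈ω → dne λ n-bound → ¬bdd (n , n∈ω , n-bound)))
    ... | n , n∈ω , n-bound with strict-upper-bound (B⊆ω a∈B) n∈ω
    ... | m , m∈ω , a∈m , n∈m with B-unb m m∈ω
    ... | b , m∈b , b∈B with τ-total (B⊆ω a∈B) (B⊆ω b∈B)
    ... | k , abk = a , b , a∈B , b∈B , <-trans (B⊆ω b∈B) a∈m m∈b , k , abk , λ k∈y →
      n-bound (k , <-trans (τ-ω abk) (<-trans (B⊆ω b∈B) n∈m m∈b) (τ-above abk)
                 , τ-member abk ax∈g , k∈y)

    module _ {B P a b} (B⊆ω : ⌜ B ⌝ ⊆ ⌜ ω ⌝) (P-matches : Matches P B)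
             (a∈B : a ∈ B) (b∈B : b ∈ B) (a∈b : a ∈ b) where

      Above : V → Set ℓ
      Above p = ∃₂ λ c d → p ≡ ⟨ c , d ⟩ × b ∈ c

      -- The elements `a < b` of `B` are arbitrary, so pairs of `P` may overlap [a,b]; only those
      -- starting above `b` are kept.
      Grafted : V → Set ℓ
      Grafted Q = ∀ p → p ∈ Q ⇔ ((p ∈ P × Above p) ⊎ p ≡ ⟨ a , b ⟩)

      grafted-exists : ∃ Grafted
      grafted-exists =
        let (T , T-spec) = comprehension (∃ᵈ ∃ᵈ (pairᵈ 2F 1F 0F ×ᵈ 3F ∈ᵈ 1F)) (b ∷ []) P in
        T ∪❴ ⟨ a , b ⟩ ❵ , λ p → (T-spec p ⊎-⇔ ⇔-id _) ⇔-∘ ∈-∪❴❵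

      private
        P-<   = proj₁ (proj₁ P-matches)
        P-sep = proj₂ (proj₁ P-matches)
        P⊆B   = proj₁ (proj₂ P-matches)

        grafted⁻ : ∀ {Q c d} → Grafted Q → ⟨ c , d ⟩ ∈ Q →
                   (⟨ c , d ⟩ ∈ P × b ∈ c) ⊎ (c ≡ a × d ≡ b)
        grafted⁻ Q-spec p with to (Q-spec _) p
        ... | inj₂ eq = inj₂ (pair-injective eq)
        ... | inj₁ (p∈P , _ , _ , eq , b∈c) with pair-injective eq
        ... | refl , refl = inj₁ (p∈P , b∈c)

        grafted-< : ∀ {Q} → Grafted Q → ∀ c d → ⟨ c , d ⟩ ∈ Q → c ∈ d
        grafted-< Q-spec c d p with grafted⁻ Q-spec p
        ... | inj₁ (p∈P , _)     = P-< c d p∈P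
        ... | inj₂ (refl , refl) = a∈b

        grafted-sep : ∀ {Q} → Grafted Q → ∀ c d c′ d′ → ⟨ c , d ⟩ ∈ Q → ⟨ c′ , d′ ⟩ ∈ Q →
                      (c ≡ c′ × d ≡ d′) ⊎ d ∈ c′ ⊎ d′ ∈ c
        grafted-sep Q-spec c d c′ d′ p q with grafted⁻ Q-spec p | grafted⁻ Q-spec q
        ... | inj₁ (p∈P , _)     | inj₁ (q∈P , _)     = P-sep c d c′ d′ p∈P q∈P
        ... | inj₁ (_ , b∈c)     | inj₂ (refl , refl) = inj₂ (inj₂ b∈c)
        ... | inj₂ (refl , refl) | inj₁ (_ , b∈c′)    = inj₂ (inj₁ b∈c′)
        ... | inj₂ (refl , refl) | inj₂ (refl , refl) = inj₁ (refl , refl)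

        grafted⊆B : ∀ {Q} → Grafted Q → ∀ c d → ⟨ c , d ⟩ ∈ Q → c ∈ B × d ∈ B
        grafted⊆B Q-spec c d p with grafted⁻ Q-spec p
        ... | inj₁ (p∈P , _)     = P⊆B c d p∈P
        ... | inj₂ (refl , refl) = a∈B , b∈B

      grafted-matches : ∀ {Q} → Grafted Q → ∃ λ z → ⌜ z ⌝ ⊆ ⌜ B ⌝ × Matches Q z
      grafted-matches Q-spec =
        separated-matches (grafted-< Q-spec , grafted-sep Q-spec) (grafted⊆B Q-spec)

      grafted-tail : Unbounded B → ∀ {Q} → Grafted Q → ∀ n → n ∈ ω →
                     ∃₂ λ c d → ⟨ c , d ⟩ ∈ P × ⟨ c , d ⟩ ∈ Q × n ∈ c
      grafted-tail B-unb Q-spec n n∈ω =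
        let (m , m∈ω , n∈m , b∈m) = strict-upper-bound n∈ω (B⊆ω b∈B)
            (c , d , p , m∈c)     = matches-tail B⊆ω P-matches B-unb m m∈ω
            c∈ω                   = B⊆ω (proj₁ (P⊆B c d p))
        in c , d , p , from (Q-spec _) (inj₁ (p , c , d , refl , <-trans c∈ω b∈m m∈c))
             , <-trans c∈ω n∈m m∈c

      grafted-unbounded : Unbounded B → ∀ {Q z} → Grafted Q → Matches Q z → Unbounded z
      grafted-unbounded B-unb Q-spec (_ , Q⊆z , _) n n∈ω =
        let (c , d , _ , q , n∈c) = grafted-tail B-unb Q-spec n n∈ω in
        c , n∈c , proj₁ (Q⊆z c d q)

      -- Pairs of `P` far enough out survive in `Q`. Their values lie in both `y` and `y′`, and
      -- exceed the entries of the pair.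
      grafted-meets : Unbounded B → ∀ {Q y y′} → Grafted Q →
                      Captures τ P y → Captures τ Q y′ → MeetsUnboundedly y y′
      grafted-meets B-unb Q-spec P-captures Q-captures n n∈ω =
        let (c , d , p , q , n∈c) = grafted-tail B-unb Q-spec n n∈ω
            (c∈ω , d∈ω)           = matches-ω B⊆ω P-matches p
            (k , pk)              = τ-total c∈ω d∈ω
        in k , <-trans (τ-ω pk) n∈c (<-trans (τ-ω pk) (P-< c d p) (τ-above pk))
             , P-captures _ k p pk , Q-captures _ k q pk

      captures-grafted : ∀ {Q y k} → Unbounded B → y ∈ 𝒜 → Captures τ P y → Grafted Q →
        (∃ λ y′ → y′ ∈ 𝒜 × Captures τ Q y′) → ⟨ ⟨ a , b ⟩ , k ⟩ ∈ τ → k ∈ y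
      captures-grafted {Q} {y} {k} B-unb y∈𝒜 P-captures Q-spec (y′ , y′∈𝒜 , Q-captures) abk =
        subst (k ∈_)
          (sym (almostDisjoint-≡ (proj₁ 𝒜-mad) y∈𝒜 y′∈𝒜
                  (grafted-meets B-unb Q-spec P-captures Q-captures)))
          (Q-captures _ k (from (Q-spec _) (inj₂ refl)) abk)

    -- Transfers capture from the pairing hidden in `Captured` to a given `Q`. `Matches` constrains
    -- only the ordered pairs in `Q`, so `Q` is asked to contain nothing else.
    captures-unique : ∀ {Q z} → ⌜ z ⌝ ⊆ ⌜ ω ⌝ → Matches Q z → Captured 𝒜 τ z →
                      (∀ p → p ∈ Q → ∃₂ λ c d → p ≡ ⟨ c , d ⟩) →
                      ∃ λ y → y ∈ 𝒜 × Captures τ Q y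
    captures-unique {Q} z⊆ω Q-matches (captured {y} {Q′} y∈𝒜 Q′-matches Q′-captures) Q-pairs =
      y , y∈𝒜 , Q-captures
      where
      Q-captures : Captures τ Q y
      Q-captures p k p∈Q pk with Q-pairs p p∈Q
      ... | c , d , refl =
        Q′-captures p k (matches-unique z⊆ω Q-matches Q′-matches c d p∈Q) pk

    captured-not-hereditary : ∀ {B} → ⌜ B ⌝ ⊆ ⌜ ω ⌝ → Unbounded B →
      ¬ (∀ z → ⌜ z ⌝ ⊆ ⌜ B ⌝ → Unbounded z → Captured 𝒜 τ z)
    captured-not-hereditary {B} B⊆ω B-unb all-captured = contradict (all-captured B id B-unb)
      where
      contradict : ¬ Captured 𝒜 τ B
      contradict (captured {y} {P} y∈𝒜 P-matches P-captures) =
        let (a , b , a∈B , b∈B , a∈b , k , abk , k∉y) = evading-pair y∈𝒜 B⊆ω B-unb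
            (Q , Q-spec) = grafted-exists B⊆ω P-matches a∈B b∈B a∈b
            (z , z⊆B , Q-matches) = grafted-matches B⊆ω P-matches a∈B b∈B a∈b Q-spec
            z-unb = grafted-unbounded B⊆ω P-matches a∈B b∈B a∈b B-unb Q-spec Q-matches
            Q-pairs : ∀ p → p ∈ Q → ∃₂ λ c d → p ≡ ⟨ c , d ⟩
            Q-pairs = λ p p∈Q → [ (λ (_ , c , d , eq , _) → c , d , eq) , (λ eq → a , b , eq) ]′
                                  (to (Q-spec p) p∈Q)
        in k∉y (captures-grafted B⊆ω P-matches a∈B b∈B a∈b B-unb y∈𝒜 P-captures Q-spec
             (captures-unique (λ c∈z → B⊆ω (z⊆B c∈z)) Q-matches (all-captured z z⊆B z-unb) Q-pairs)
             abk)

    -- The coloring has no homogeneous set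

    captured-not-ramsey : DependentChoice → ∀ {S} →
      (∀ z → z ∈ S ⇔ (⌜ z ⌝ ⊆ ⌜ ω ⌝ × Unbounded z × Captured 𝒜 τ z)) →
      ¬ HasRamseyProperty S
    captured-not-ramsey dc S-spec (B , (B⊆ω , B-inf) , inj₁ B⊆S) =
      captured-not-hereditary B⊆ω (countablyInfinite⇒unbounded B⊆ω B-inf)
        λ z z⊆B z-unb → proj₂ (proj₂ (to (S-spec z)
          (B⊆S (z⊆B , unbounded⇒countablyInfinite (λ c∈z → B⊆ω (z⊆B c∈z)) z-unb))))
    captured-not-ramsey dc S-spec (B , (B⊆ω , B-inf) , inj₂ B∩S≡∅) =
      let (z , z⊆B , z-unb , z-captured) =
            captured-exists dc B⊆ω (countablyInfinite⇒unbounded B⊆ω B-inf)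
          z⊆ω : ⌜ z ⌝ ⊆ ⌜ ω ⌝
          z⊆ω = λ c∈z → B⊆ω (z⊆B c∈z)
      in B∩S≡∅ ( (z⊆B , unbounded⇒countablyInfinite z⊆ω z-unb)
               , from (S-spec z) (z⊆ω , z-unb , z-captured))

  no-infinite-mad : DependentChoice → (∀ S → ⌜ S ⌝ ⊆ [ ω ]^∞ → HasRamseyProperty S) →
                    ¬ (∃ λ 𝒜 → IsMad 𝒜 × ¬ Finite ⌜ 𝒜 ⌝)
  no-infinite-mad dc ramsey (𝒜 , 𝒜-mad , 𝒜-inf) =
    let (g , g-fun , g-inj) = distinct-sequence dc 𝒜-inf
        (τ , τ-sel)         = selector (proj₁ (proj₁ 𝒜-mad)) g-fun
        (S , S-spec)        = captured-set 𝒜 τ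
    in captured-not-ramsey 𝒜-mad g-fun g-inj τ-sel dc S-spec (ramsey S λ {z} z∈S →
         let (z⊆ω , z-unb , _) = to (S-spec z) z∈S in
         z⊆ω , unbounded⇒countablyInfinite z⊆ω z-unb)

theorem1p1 : ∀ {ℓ} → ExcludedMiddle ℓ →
    (𝕍 : ZFModel ℓ) → let open InModel 𝕍 in
    DependentChoice → RUnif →
    (∀ S → ⌜ S ⌝ ⊆ [ ω ]^∞ → HasRamseyProperty S) →
    ¬ (∃ λ 𝒜 → IsMad 𝒜 × ¬ Finite ⌜ 𝒜 ⌝)
theorem1p1 em 𝕍 dc _ = MadFamilies.no-infinite-mad em 𝕍 dc
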